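{- Every oriented graph whose missing edges form a matching and which does not contain a sink contains at least two vertices with large second neighborhoods.
   Context: All graphs are finite and simple, with nonempty vertex set. An oriented graph is a digraph without loops or digons. For an oriented graph $D$, $N_D^+(v)$ and $N_D^-(v)$ are the out- and in-neighborhoods of $v$; $N_D^{++}(v)=\{u\in V(D)\setminus(\{v\}\cup N_D^+(v)) : N_D^-(u)\cap N_D^+(v)\neq\emptyset\}$. A vertex $v$ has a large second neighborhood if $|N_D^{++}(v)|\ge |N_D^+(v)|$. A sink is a vertex with out-degree zero. A missing edge of $D$ is an unordered pair of distinct vertices with no arc between them; the missing edges form a (possibly empty) matching if every vertex belongs to at most one missing edge. -}

module Defs where

open import Data.Fin.Base using (Fin)
open import Data.Fin.Subset using (Subset; ∣_∣; _∉_; ⁅_⁆; _∪_; _∩_; Nonempty)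
open import Data.Fin.Subset.Properties using (_∈?_; nonempty?)
open import Data.Nat.Base using (ℕ; _≥_)
open import Data.Product.Base using (_×_)
open import Data.Vec.Base using (tabulate)
open import Level using (0ℓ)
open import Relation.Binary.Core using (Rel)
open import Relation.Binary.Definitions using (Asymmetric; Decidable)
open import Relation.Binary.PropositionalEquality using (_≡_; _≢_)
open import Relation.Nullary.Decidable using (does; ¬?; _×-dec_)
open import Relation.Nullary.Negation using (¬_)
import Relation.Unary as Unary

⟦_⟧ : ∀ {n} {P : Unary.Pred (Fin n) 0ℓ} → Unary.Decidable P → Subset n
⟦ P? ⟧ = tabulate (λ u → does (P? u))

record OrientedGraph (n : ℕ) : Set₁ where
  infix 4 _⟶_ _⟶?_
  field
    _⟶_      : Rel (Fin n) 0ℓ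
    _⟶?_     : Decidable _⟶_
    no-loops  : ∀ v → ¬ (v ⟶ v)
    no-digons : Asymmetric _⟶_

  N⁺ : Fin n → Subset n
  N⁺ v = ⟦ (λ u → v ⟶? u) ⟧

  N⁻ : Fin n → Subset n
  N⁻ v = ⟦ (λ u → u ⟶? v) ⟧

  IsSecondOutNeighbor : Fin n → Fin n → Set
  IsSecondOutNeighbor v u = u ∉ ⁅ v ⁆ ∪ N⁺ v × Nonempty (N⁻ u ∩ N⁺ v)

  isSecondOutNeighbor? : Decidable IsSecondOutNeighbor
  isSecondOutNeighbor? v u =
    ¬? (u ∈? ⁅ v ⁆ ∪ N⁺ v) ×-dec nonempty? (N⁻ u ∩ N⁺ v)

  N⁺⁺ : Fin n → Subset n
  N⁺⁺ v = ⟦ isSecondOutNeighbor? v ⟧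

  LargeSecondNeighborhood : Fin n → Set
  LargeSecondNeighborhood v = ∣ N⁺⁺ v ∣ ≥ ∣ N⁺ v ∣

  Sink : Fin n → Set
  Sink v = ∣ N⁺ v ∣ ≡ 0

  -- A symmetric relation, so that {u , v} is an unordered pair.
  MissingEdge : Fin n → Fin n → Set
  MissingEdge u v = u ≢ v × ¬ (u ⟶ v) × ¬ (v ⟶ u)

  -- The missing edges at v are the pairs {v , x}, so "at most one missing
  -- edge contains v" says that the other endpoint is unique.
  MissingEdgesFormMatching : Set
  MissingEdgesFormMatching =
    ∀ {v x y} → MissingEdge v x → MissingEdge v y → x ≡ y

module Submission where

-- Weighted median orders (Havet–Thomassé). If f is the last vertex of a median order of a weighted
-- tournament and o is a set of out-neighbours of f, then o weighs at most as much as the set of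
-- vertices outside o that have an in-neighbour in o. If equality holds, the order can be sedimented,
-- that is, all vertices outside these two sets (f among them) can be moved to the front without
-- losing optimality. To find a second vertex, delete the last vertex x (of weight 1), fix an
-- out-neighbour y of x, and take a median order of the rest in which y comes as late as possible:
-- its last vertex also works once x is put back.
--
-- To reach tournaments, we orient the missing edges along the dependency relation of Fidler and
-- Yuster: {θ x , θ (π x)} forces the orientation of {x , π x}, where π is the partner in the missing
-- matching. Each missing edge has at most one predecessor and one successor, so the dependency
-- digraph consists of paths and cycles. Paths can be oriented consistently, starting from an end that
-- can be oriented without creating second neighbours. The vertices of a cycle form a module in which
-- every vertex has a large second neighborhood; contracting it to one vertex, weighted by its size,
-- leaves a tournament, and if the contracted vertex is large, then so are all vertices of the module.

open import Defs
open import Data.Bool.Base using (if_then_else_)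
open import Data.Fin.Base using (Fin; zero; suc; toℕ; fromℕ<)
import Data.Fin.Properties as Fin
open import Data.Fin.Subset using (∣_∣) renaming (_∈_ to _∈ₛ_)
open import Data.Fin.Subset.Properties using (x∈⁅y⁆⇒x≡y; x∈p∪q⁻; x∈p∩q⁺)
open import Data.List.Base using (List; []; _∷_; [_]; _++_; map; filter; length; allFin; initLast; _∷ʳ′_)
  renaming (tabulate to tabulateˡ)
import Data.List.Membership.DecPropositional as DecMembership
open import Data.List.Membership.Propositional using (_∈_; find; lose)
open import Data.List.Membership.Propositional.Properties
  using (∈-++⁺ʳ; ∈-++⁻; ∈-filter⁺; ∈-filter⁻; ∈-∃++; ∈-allFin)
open import Data.List.Properties using (++-assoc; ++-identityʳ; ∷-injective; filter-++; map-++)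
open import Data.List.Relation.Binary.Permutation.Propositional
  using (_↭_; ↭⇒↭ₛ; ↭-refl; ↭-sym; ↭-trans; ↭-reflexive; prep; refl; swap)
open import Data.List.Relation.Binary.Permutation.Propositional.Properties
  using (shift; drop-mid; Any-resp-↭; map⁺; ++⁺ˡ; ++⁺ʳ; ++-comm; ∈-resp-↭; ↭-empty-inv; ↭-length)
open import Data.List.Relation.Binary.Permutation.Setoid.Properties using (Unique-resp-↭)
open import Data.List.Relation.Unary.All using (All; []; _∷_)
import Data.List.Relation.Unary.All as All
import Data.List.Relation.Unary.All.Properties as All
open import Data.List.Relation.Unary.AllPairs using ([]; _∷_)
open import Data.List.Relation.Unary.Any using (Any; here; there; any?)
open import Data.List.Relation.Unary.Unique.Propositional using (Unique)
open import Data.List.Relation.Unary.Unique.Propositional.Properties using (allFin⁺; filter⁺)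
open import Data.Nat.Base
open import Data.Nat.GeneralisedArithmetic using (fold; fold-+)
open import Data.Nat.ListAction using (sum)
open import Data.Nat.ListAction.Properties using (sum-++; sum-↭)
open import Data.Nat.Properties
open import Data.Nat.Tactic.RingSolver using (solve-∀)
open import Data.Product.Base using (_×_; _,_; proj₁; proj₂; ∃₂; ∃-syntax)
open import Data.Sum.Base using (_⊎_; inj₁; inj₂; [_,_]′)
open import Data.Vec.Base using (tabulate)
open import Data.Vec.Properties using ([]=⇒lookup; lookup⇒[]=; lookup∘tabulate)
open import Function.Base using (_∘_; id)
open import Level using (0ℓ)
open import Relation.Binary.Core using (Rel)
open import Relation.Binary.Definitions using (Asymmetric; DecidableEquality; tri<; tri≈; tri>)
  renaming (Decidable to Decidable₂)
open import Relation.Binary.PropositionalEquality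
  using (_≡_; _≢_; refl; sym; trans; cong; cong₂; subst; subst₂)
  renaming (setoid to ≡-setoid)
open import Relation.Nullary.Decidable
  using (Dec; yes; no; does; dec-true; dec-false; ¬?; _×-dec_; _⊎-dec_; decidable-stable)
open import Relation.Nullary.Negation using (¬_; contradiction)
open import Relation.Unary using (Pred; Decidable)

-- Indicators and finite sums.

private variable
  A B : Set
  P Q : Set

𝟙 : Dec P → ℕ
𝟙 P? = if does P? then 1 else 0

𝟙-yes : (P? : Dec P) → P → 𝟙 P? ≡ 1
𝟙-yes P? p rewrite dec-true P? p = refl

𝟙-no : (P? : Dec P) → ¬ P → 𝟙 P? ≡ 0
𝟙-no P? ¬p rewrite dec-false P? ¬p = refl

𝟙-mono : (P? : Dec P) (Q? : Dec Q) → (P → Q) → 𝟙 P? ≤ 𝟙 Q?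
𝟙-mono (no _)  Q? f = z≤n
𝟙-mono (yes p) Q? f = ≤-reflexive (sym (𝟙-yes Q? (f p)))

𝟙≤1 : (P? : Dec P) → 𝟙 P? ≤ 1
𝟙≤1 (yes _) = ≤-refl
𝟙≤1 (no _)  = z≤n

∑ : (A → ℕ) → List A → ℕ
∑ f xs = sum (map f xs)

∑-++ : ∀ (f : A → ℕ) xs ys → ∑ f (xs ++ ys) ≡ ∑ f xs + ∑ f ys
∑-++ f xs ys = trans (cong sum (map-++ f xs ys)) (sum-++ (map f xs) (map f ys))

∑-↭ : ∀ (f : A → ℕ) {xs ys} → xs ↭ ys → ∑ f xs ≡ ∑ f ys
∑-↭ f p = sum-↭ (map⁺ f p)

∑-mono : ∀ {f g : A → ℕ} xs → (∀ {x} → x ∈ xs → f x ≤ g x) → ∑ f xs ≤ ∑ g xs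
∑-mono []       f≤g = z≤n
∑-mono (x ∷ xs) f≤g = +-mono-≤ (f≤g (here refl)) (∑-mono xs (f≤g ∘ there))

∑-cong : ∀ {f g : A → ℕ} xs → (∀ {x} → x ∈ xs → f x ≡ g x) → ∑ f xs ≡ ∑ g xs
∑-cong xs f≡g = ≤-antisym (∑-mono xs (≤-reflexive ∘ f≡g)) (∑-mono xs (≤-reflexive ∘ sym ∘ f≡g))

∑-+ : ∀ (f g : A → ℕ) xs → ∑ (λ x → f x + g x) xs ≡ ∑ f xs + ∑ g xs
∑-+ f g []       = refl
∑-+ f g (x ∷ xs) rewrite ∑-+ f g xs = lemma (f x) (g x) (∑ f xs) (∑ g xs)
  where
  lemma : ∀ a b c d → a + b + (c + d) ≡ a + c + (b + d)
  lemma = solve-∀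

∑-zero : ∀ (xs : List A) → ∑ (λ _ → 0) xs ≡ 0
∑-zero []       = refl
∑-zero (_ ∷ xs) = ∑-zero xs

∑-*ˡ : ∀ k (f : A → ℕ) xs → ∑ (λ x → k * f x) xs ≡ k * ∑ f xs
∑-*ˡ k f []       = sym (*-zeroʳ k)
∑-*ˡ k f (x ∷ xs) rewrite ∑-*ˡ k f xs = sym (*-distribˡ-+ k (f x) (∑ f xs))

∑-swap : ∀ (f : A → B → ℕ) xs ys →
         ∑ (λ x → ∑ (f x) ys) xs ≡ ∑ (λ y → ∑ (λ x → f x y) xs) ys
∑-swap f []       ys = sym (∑-zero ys)
∑-swap f (x ∷ xs) ys rewrite ∑-swap f xs ys = sym (∑-+ (f x) _ ys)

∑-δ : ∀ {A : Set} (_≟_ : DecidableEquality A) (h : A → ℕ) {w} L → Unique L → w ∈ L →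
      ∑ (λ v → h v * 𝟙 (w ≟ v)) L ≡ h w
∑-δ _≟_ h {w} (w ∷ L) (w∉ ∷ _) (here refl)
  rewrite 𝟙-yes (w ≟ w) refl
        | ∑-cong {f = λ v → h v * 𝟙 (w ≟ v)} {g = λ _ → 0} L
            (λ {v} v∈L → trans (cong (h v *_) (𝟙-no (w ≟ v) (All.lookup w∉ v∈L))) (*-zeroʳ (h v)))
        | ∑-zero L | *-identityʳ (h w) = +-identityʳ (h w)
∑-δ _≟_ h {w} (v ∷ L) (v∉ ∷ u) (there w∈L)
  rewrite 𝟙-no (w ≟ v) (λ w≡v → All.lookup v∉ w∈L (sym w≡v)) | *-zeroʳ (h v) = ∑-δ _≟_ h L u w∈L

∑-unique : ∀ {A : Set} {p : Pred A 0ℓ} {Q : Set} (p? : Decidable p) (Q? : Dec Q) L → Unique L →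
  (∀ {u} → p u → Q) → (∀ {u v} → p u → p v → u ≡ v) → ∑ (𝟙 ∘ p?) L ≤ 𝟙 Q?
∑-unique p? Q? [] _ _ _ = z≤n
∑-unique p? Q? (u ∷ L) (u∉ ∷ uniq) p⇒Q p! with p? u
... | no _   = ∑-unique p? Q? L uniq p⇒Q p!
... | yes pu rewrite 𝟙-yes Q? (p⇒Q pu)
                   | ∑-cong {f = 𝟙 ∘ p?} {g = λ _ → 0} L
                       (λ {v} v∈L → 𝟙-no (p? v) (λ pv → All.lookup u∉ v∈L (p! pu pv)))
                   | ∑-zero L = ≤-refl

𝟙-split : ∀ {P Q : Set} (P? : Dec P) (Q? : Dec Q) → 𝟙 P? ≡ 𝟙 (P? ×-dec Q?) + 𝟙 (P? ×-dec ¬? Q?)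
𝟙-split (yes _) (yes _) = refl
𝟙-split (yes _) (no _)  = refl
𝟙-split (no _)  _       = refl

-- Counting vertices.

module _ {n : ℕ} where

  #_ : ∀ {p : Pred (Fin n) 0ℓ} → Decidable p → ℕ
  # p? = ∑ (𝟙 ∘ p?) (allFin n)

  #-mono : ∀ {p q : Pred (Fin n) 0ℓ} (p? : Decidable p) (q? : Decidable q) →
    (∀ {u} → p u → q u) → # p? ≤ # q?
  #-mono p? q? p⊆q = ∑-mono (allFin n) λ {u} _ → 𝟙-mono (p? u) (q? u) p⊆q

  #-singleton : ∀ (w : Fin n) → # (w Fin.≟_) ≡ 1
  #-singleton w = trans (∑-cong (allFin n) (λ _ → sym (*-identityˡ _)))
                        (∑-δ Fin._≟_ (λ _ → 1) (allFin n) (allFin⁺ n) (∈-allFin w))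

  #-split : ∀ {p q : Pred (Fin n) 0ℓ} (p? : Decidable p) (q? : Decidable q) →
    # p? ≡ # (λ u → p? u ×-dec q? u) + # (λ u → p? u ×-dec ¬? (q? u))
  #-split p? q? = trans (∑-cong (allFin n) (λ {u} _ → 𝟙-split (p? u) (q? u))) (∑-+ _ _ (allFin n))

  -- Double counting of the pairs `(u , φ u)`: every `u` lies in one of them, and injectivity leaves
  -- at most one for each `v`.
  #-injection : ∀ {p q : Pred (Fin n) 0ℓ} (p? : Decidable p) (q? : Decidable q) (φ : Fin n → Fin n) →
    (∀ {u} → p u → q (φ u)) → (∀ {u v} → p u → p v → φ u ≡ φ v → u ≡ v) → # p? ≤ # q?
  #-injection p? q? φ p⇒q inj = begin
    # p?
      ≤⟨ ∑-mono (allFin n) (λ {u} _ → fibre u) ⟩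
    ∑ (λ u → ∑ (λ v → 𝟙 (p? u ×-dec (φ u Fin.≟ v))) (allFin n)) (allFin n)
      ≡⟨ ∑-swap _ (allFin n) (allFin n) ⟩
    ∑ (λ v → ∑ (λ u → 𝟙 (p? u ×-dec (φ u Fin.≟ v))) (allFin n)) (allFin n)
      ≤⟨ ∑-mono (allFin n) (λ {v} _ → ∑-unique
           (λ u → p? u ×-dec (φ u Fin.≟ v)) (q? v) (allFin n) (allFin⁺ n)
           (λ { (pu , refl) → p⇒q pu }) (λ { (pu , refl) (pv , eq) → inj pu pv (sym eq) })) ⟩
    # q? ∎
    where
    open ≤-Reasoning
    fibre : ∀ u → 𝟙 (p? u) ≤ ∑ (λ v → 𝟙 (p? u ×-dec (φ u Fin.≟ v))) (allFin n)
    fibre u with p? u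
    ... | no _  = z≤n
    ... | yes _ = ≤-reflexive (sym (#-singleton (φ u)))

∣⟦⟧∣ : ∀ {n} {p : Pred (Fin n) 0ℓ} (p? : Decidable p) → ∣ ⟦ p? ⟧ ∣ ≡ # p?
∣⟦⟧∣ {n} p? = go n id
  where
  go : ∀ m (f : Fin m → Fin n) → ∣ tabulate (does ∘ p? ∘ f) ∣ ≡ ∑ (𝟙 ∘ p?) (tabulateˡ f)
  go zero f = refl
  go (suc m) f with p? (f zero)
  ... | yes _ = cong suc (go m (f ∘ suc))
  ... | no _  = go m (f ∘ suc)

∈⟦⟧⁺ : ∀ {n} {p : Pred (Fin n) 0ℓ} (p? : Decidable p) {u} → p u → u ∈ₛ ⟦ p? ⟧
∈⟦⟧⁺ p? {u} pu = lookup⇒[]= u _ (trans (lookup∘tabulate _ u) (dec-true (p? u) pu))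

∈⟦⟧⁻ : ∀ {n} {p : Pred (Fin n) 0ℓ} (p? : Decidable p) {u} → u ∈ₛ ⟦ p? ⟧ → p u
∈⟦⟧⁻ p? {u} u∈ with p? u | trans (sym (lookup∘tabulate _ u)) ([]=⇒lookup u∈)
... | yes pu | _ = pu
... | no _   | ()

-- Median orders

-- One round of the search in `maximal-permutation`. Composing `μ` with `y ∷_` turns insertions
-- behind `y` into insertions into the tail; the front position is compared separately.
insert-maximal : ∀ (μ : List A → ℕ) x L →
  ∃[ N ] (N ↭ x ∷ L × (∀ P R → P ++ R ≡ L → μ (P ++ x ∷ R) ≤ μ N))
insert-maximal μ x [] = [ x ] , ↭-refl , λ { [] [] refl → ≤-refl }
insert-maximal μ x (y ∷ L)
  with N , N↭ , max ← insert-maximal (μ ∘ (y ∷_)) x L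
  with ≤-total (μ (x ∷ y ∷ L)) (μ (y ∷ N))
... | inj₁ le = y ∷ N , ↭-trans (prep y N↭) (swap y x refl) ,
                λ { [] R refl → le ; (_ ∷ P) R refl → max P R refl }
... | inj₂ ge = x ∷ y ∷ L , ↭-refl ,
                λ { [] R refl → ≤-refl ; (_ ∷ P) R refl → ≤-trans (max P R refl) ge }

-- Every permutation of `x ∷ S` arises by inserting `x` into a permutation of `S`, so it suffices to
-- maximise the value of the best insertion. `μ` is arbitrary because a tie-breaking term will be
-- added to the weight of the forward arcs.
maximal-permutation : ∀ (μ : List A → ℕ) S →
  ∃[ M ] (M ↭ S × (∀ L → L ↭ S → μ L ≤ μ M))
maximal-permutation μ [] = [] , ↭-refl , λ L p → ≤-reflexive (cong μ (↭-empty-inv p))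
maximal-permutation μ (x ∷ S) =
  let ins     = insert-maximal μ x
      M , M↭ , max = maximal-permutation (μ ∘ proj₁ ∘ ins) S
      N , N↭ , _  = ins M
  in N , ↭-trans N↭ (prep x M↭) , λ L L↭ → bound L L↭ max
  where
  bound : ∀ L → L ↭ x ∷ S → ∀ {M} →
          (∀ L → L ↭ S → μ (proj₁ (insert-maximal μ x L)) ≤ M) → μ L ≤ M
  bound L L↭ max with P , R , refl ← ∈-∃++ (∈-resp-↭ (↭-sym L↭) (here refl)) =
    ≤-trans (proj₂ (proj₂ (insert-maximal μ x (P ++ R))) P R refl)
            (max (P ++ R) (drop-mid P [] L↭))

-- Weighted tournaments.

module WeightedTournament {A : Set} (_≟_ : DecidableEquality A)
  (_⇒_ : Rel A 0ℓ) (_⇒?_ : Decidable₂ _⇒_)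
  (asym : Asymmetric _⇒_) (connex : ∀ {x y} → x ≢ y → x ⇒ y ⊎ y ⇒ x)
  (ω : A → ℕ) where

  private variable p q : Pred A 0ℓ

  weight : Decidable p → List A → ℕ
  weight p? = ∑ (λ u → 𝟙 (p? u) * ω u)

  weight-++ : ∀ (p? : Decidable p) L M → weight p? (L ++ M) ≡ weight p? L + weight p? M
  weight-++ p? = ∑-++ _

  weight-mono : ∀ (p? : Decidable p) (q? : Decidable q) L →
    (∀ {u} → u ∈ L → p u → q u) → weight p? L ≤ weight q? L
  weight-mono p? q? L p⊆q = ∑-mono L λ {u} u∈L → *-monoˡ-≤ (ω u) (𝟙-mono (p? u) (q? u) (p⊆q u∈L))

  weight-mono-< : ∀ (p? : Decidable p) (q? : Decidable q) L → (∀ {u} → p u → q u) →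
    ∀ {y} → y ∈ L → ¬ p y → q y → 0 < ω y → weight p? L < weight q? L
  weight-mono-< p? q? (y ∷ L) p⊆q (here refl) ¬py qy 0<ωy
    rewrite 𝟙-no (p? y) ¬py | 𝟙-yes (q? y) qy | +-identityʳ (ω y) =
    +-mono-<-≤ 0<ωy (weight-mono p? q? L (λ _ → p⊆q))
  weight-mono-< p? q? (u ∷ L) p⊆q (there y∈L) ¬py qy 0<ωy =
    +-mono-≤-< (*-monoˡ-≤ (ω u) (𝟙-mono (p? u) (q? u) p⊆q))
               (weight-mono-< p? q? L p⊆q y∈L ¬py qy 0<ωy)

  weight-filter-≤ : ∀ (p? : Decidable p) (q? : Decidable q) L → weight p? (filter q? L) ≤ weight p? L
  weight-filter-≤ p? q? [] = z≤n
  weight-filter-≤ p? q? (u ∷ L) with q? u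
  ... | yes _ = +-monoʳ-≤ (𝟙 (p? u) * ω u) (weight-filter-≤ p? q? L)
  ... | no  _ = ≤-trans (weight-filter-≤ p? q? L) (m≤n+m _ _)

  weight-filter-⊆ : ∀ (p? : Decidable p) (q? : Decidable q) → (∀ {u} → p u → q u) → ∀ L →
    weight p? L ≤ weight p? (filter q? L)
  weight-filter-⊆ p? q? p⊆q [] = z≤n
  weight-filter-⊆ p? q? p⊆q (u ∷ L) with q? u
  ... | yes _  = +-monoʳ-≤ (𝟙 (p? u) * ω u) (weight-filter-⊆ p? q? p⊆q L)
  ... | no ¬qu rewrite 𝟙-no (p? u) (¬qu ∘ p⊆q) = weight-filter-⊆ p? q? p⊆q L

  _⇐?_ : ∀ u v → Dec (v ⇒ u)
  u ⇐? v = v ⇒? u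

  -- The weight of the arcs that point forward in the list, an arc `x ⇒ y` weighing `ω x * ω y`;
  -- median orders maximise it.
  forward : List A → ℕ
  forward []      = 0
  forward (x ∷ L) = ω x * weight (x ⇒?_) L + forward L

  forward-insert : ∀ L b R →
    forward (L ++ b ∷ R) ≡ ω b * weight (b ⇐?_) L + ω b * weight (b ⇒?_) R + forward (L ++ R)
  forward-insert [] b R rewrite *-zeroʳ (ω b) = refl
  forward-insert (x ∷ L) b R
    rewrite forward-insert L b R
          | weight-++ (x ⇒?_) L (b ∷ R)
          | weight-++ (x ⇒?_) L R
    = lemma (ω x) (ω b) (weight (x ⇒?_) L) (𝟙 (x ⇒? b)) (weight (x ⇒?_) R)
            (weight (b ⇐?_) L) (weight (b ⇒?_) R) (forward (L ++ R))
    where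
    lemma : ∀ x b l t r i j f → x * (l + (t * b + r)) + (b * i + b * j + f)
                              ≡ b * (t * x + i) + b * j + (x * (l + r) + f)
    lemma = solve-∀

  -- Only the arcs between `b` and `I` are affected. Each side carries a summand so that no
  -- truncated subtraction occurs.
  forward-move : ∀ P I b R →
    forward (P ++ b ∷ I ++ R) + ω b * weight (b ⇐?_) I ≡
    forward ((P ++ I) ++ b ∷ R) + ω b * weight (b ⇒?_) I
  forward-move P I b R
    rewrite forward-insert P b (I ++ R)
          | forward-insert (P ++ I) b R
          | weight-++ (b ⇒?_) I R
          | weight-++ (b ⇐?_) P I
          | ++-assoc P I R
    = lemma (ω b) (weight (b ⇐?_) P) (weight (b ⇒?_) I) (weight (b ⇒?_) R)
            (weight (b ⇐?_) I) (forward (P ++ I ++ R))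
    where
    lemma : ∀ b p i r j f → b * p + b * (i + r) + f + b * j
                          ≡ b * (p + j) + b * r + f + b * i
    lemma = solve-∀

  IsMedian : List A → Set
  IsMedian M = ∀ L → L ↭ M → forward L ≤ forward M

  -- Moving `b` in front of `I` cannot increase `forward`; the positive factor `ω b` is then
  -- cancelled.
  feedback : ∀ {M} → IsMedian M → ∀ P I b R → M ≡ P ++ I ++ b ∷ R → 0 < ω b →
             weight (b ⇒?_) I ≤ weight (b ⇐?_) I
  feedback med P I b R refl 0<ωb = *-cancelˡ-≤ (ω b) {{>-nonZero 0<ωb}}
    (+-cancelˡ-≤ (forward (P ++ I ++ b ∷ R)) _ _ (begin
      forward (P ++ I ++ b ∷ R) + ω b * weight (b ⇒?_) I
        ≡⟨ cong (λ L → forward L + ω b * weight (b ⇒?_) I) (++-assoc P I (b ∷ R)) ⟨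
      forward ((P ++ I) ++ b ∷ R) + ω b * weight (b ⇒?_) I
        ≡⟨ forward-move P I b R ⟨
      forward (P ++ b ∷ I ++ R) + ω b * weight (b ⇐?_) I
        ≤⟨ +-monoˡ-≤ _ (med (P ++ b ∷ I ++ R) (++⁺ˡ P (↭-sym (shift b I R)))) ⟩
      forward (P ++ I ++ b ∷ R) + ω b * weight (b ⇐?_) I ∎))
    where open ≤-Reasoning

  last-segment : ∀ {f : A} Q P I → Q ++ [ f ] ≡ P ++ I → I ≡ [] ⊎ f ∈ I
  last-segment Q       P       []      eq = inj₁ refl
  last-segment Q       []      (i ∷ I) eq = inj₂ (subst (_ ∈_) eq (∈-++⁺ʳ Q (here refl)))
  last-segment []      (_ ∷ [])    (_ ∷ _) ()
  last-segment []      (_ ∷ _ ∷ _) (_ ∷ _) ()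
  last-segment (_ ∷ Q) (_ ∷ P) (i ∷ I) eq = last-segment Q P (i ∷ I) (proj₂ (∷-injective eq))

  -- Positions and sedimentation.

  position : A → List A → ℕ
  position y []      = 0
  position y (u ∷ L) = if does (u ≟ y) then 0 else suc (position y L)

  position≤length : ∀ y L → position y L ≤ length L
  position≤length y []      = z≤n
  position≤length y (u ∷ L) with u ≟ y
  ... | yes _ = z≤n
  ... | no  _ = s≤s (position≤length y L)

  position-++ : ∀ {y} L {M} → ¬ (y ∈ L) → position y (L ++ M) ≡ length L + position y M
  position-++ []      _   = refl
  position-++ {y} (u ∷ L) y∉ with u ≟ y
  ... | yes refl = contradiction (here refl) y∉
  ... | no _     = cong suc (position-++ L (y∉ ∘ there))

  module _ (p? : Decidable p) where

    sediment : List A → List A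
    sediment L = filter p? L ++ filter (¬? ∘ p?) L

    sediment-↭ : ∀ L → sediment L ↭ L
    sediment-↭ [] = refl
    sediment-↭ (u ∷ L) with p? u
    ... | yes _ = prep u (sediment-↭ L)
    ... | no  _ = ↭-trans (shift u (filter p? L) _) (prep u (sediment-↭ L))

    -- Whatever precedes `y` still does so after the rearrangement, and `f` overtakes `y`.
    position-sediment : ∀ {y f} Q → ¬ p y → p f → y ∈ Q →
      position y (Q ++ [ f ]) < position y (sediment (Q ++ [ f ]))
    position-sediment {y} {f} Q ¬py pf y∈Q =
      subst (position y (Q ++ [ f ]) <_)
        (sym (position-++ (filter p? (Q ++ [ f ]))
                (¬py ∘ proj₂ ∘ ∈-filter⁻ p? {xs = Q ++ [ f ]})))
        (count Q y∈Q)
      where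
      0<length : ∀ L → 0 < length (filter p? (L ++ [ f ]))
      0<length [] with p? f
      ... | yes _  = s≤s z≤n
      ... | no ¬pf = contradiction pf ¬pf
      0<length (u ∷ L) with p? u
      ... | yes _ = s≤s z≤n
      ... | no  _ = 0<length L
      count : ∀ L → y ∈ L → position y (L ++ [ f ]) <
        length (filter p? (L ++ [ f ])) + position y (filter (¬? ∘ p?) (L ++ [ f ]))
      count (u ∷ L) y∈ with u ≟ y in u≟y | p? u
      count (u ∷ L) y∈         | yes refl | yes py = contradiction py ¬py
      count (u ∷ L) y∈         | yes refl | no _   = ≤-trans (0<length L) (m≤m+n _ _)
      count (u ∷ L) (here refl) | no u≢y  | _      = contradiction refl u≢y
      count (u ∷ L) (there y∈) | no _     | yes _  = s≤s (count L y∈)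
      count (u ∷ L) (there y∈) | no _     | no _ rewrite u≟y =
        subst (suc (position y (L ++ [ f ])) <_) (sym (+-suc (length (filter p? (L ++ [ f ]))) _))
          (s≤s (count L y∈))

  -- Good and bad vertices of a median order.

  module Feed (M Q : List A) (f : A) (M≡ : M ≡ Q ++ [ f ]) (med : IsMedian M)
    (ω>0 : ∀ {u} → u ∈ M → 0 < ω u)
    {o n : Pred A 0ℓ} (o? : Decidable o) (n? : Decidable n)
    (o⇒n : ∀ {z u} → o z → z ⇒ u → n u)
    (f⇒o : ∀ {z} → o z → f ⇒ z) (¬nf : ¬ n f) where

    g? : Decidable (λ u → ¬ o u × n u)
    g? u = ¬? (o? u) ×-dec n? u

    -- The vertices to be moved to the front. They cut the order into intervals, and on each
    -- interval the feedback property compares `o` with the gained vertices `g?`.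
    Bad : Pred A 0ℓ
    Bad u = ¬ o u × ¬ n u

    abstract
      bad? : Decidable Bad
      bad? u = ¬? (o? u) ×-dec ¬? (n? u)

    good? : Decidable (¬_ ∘ Bad)
    good? = ¬? ∘ bad?

    f-bad : Bad f
    f-bad = (λ of → asym (f⇒o of) (f⇒o of)) , ¬nf

    bad⇒o : ∀ {b z} → Bad b → o z → b ⇒ z
    bad⇒o {b} {z} (¬ob , ¬nb) oz with connex {b} {z} (λ { refl → ¬ob oz })
    ... | inj₁ b⇒z = b⇒z
    ... | inj₂ z⇒b = contradiction (o⇒n oz z⇒b) ¬nb

    good-⇒bad : ∀ {b z} → Bad b → ¬ Bad z → z ⇒ b → ¬ o z × n z
    good-⇒bad {b} {z} (_ , ¬nb) ¬bz z⇒b = ¬oz , decidable-stable (n? z) (λ ¬nz → ¬bz (¬oz , ¬nz))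
      where
      ¬oz : ¬ o z
      ¬oz oz = ¬nb (o⇒n oz z⇒b)

    -- `b` dominates the members of `o` in `I`, while its in-neighbours in `I`, being good, are
    -- gained. `feedback` compares the two sets.
    interval : ∀ P I b R → M ≡ P ++ I ++ b ∷ R → Bad b → All (¬_ ∘ Bad) I → weight o? I ≤ weight g? I
    interval P I b R eq bb ¬bI = begin
      weight o? I       ≤⟨ weight-mono o? (b ⇒?_) I (λ _ → bad⇒o bb) ⟩
      weight (b ⇒?_) I  ≤⟨ feedback med P I b R eq
                                (ω>0 (subst (b ∈_) (sym eq) (∈-++⁺ʳ P (∈-++⁺ʳ I (here refl))))) ⟩
      weight (b ⇐?_) I  ≤⟨ weight-mono (b ⇐?_) g? I (λ z∈I → good-⇒bad bb (All.lookup ¬bI z∈I)) ⟩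
      weight g? I       ∎
      where open ≤-Reasoning

    -- `I` collects the good vertices read since the last cut. When a bad vertex `u` is met,
    -- `interval` settles `I` and the induction restarts behind `u`.
    suffix : ∀ P I R → M ≡ P ++ I ++ R → All (¬_ ∘ Bad) I → weight o? (I ++ R) ≤ weight g? (I ++ R)
    suffix P I [] eq ¬bI
      -- The order ends with the bad vertex `f`, so no good vertices are left over.
      with last-segment Q P I (trans (sym M≡) (trans eq (cong (P ++_) (++-identityʳ I))))
    ... | inj₁ refl = z≤n
    ... | inj₂ f∈I  = contradiction f-bad (All.lookup ¬bI f∈I)
    suffix P I (u ∷ R) eq ¬bI with bad? u
    ... | no ¬bu =
      subst (λ L → weight o? L ≤ weight g? L) (++-assoc I [ u ] R)
        (suffix P (I ++ [ u ]) R (trans eq (cong (P ++_) (sym (++-assoc I [ u ] R))))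
          (All.++⁺ ¬bI (¬bu ∷ [])))
    ... | yes bu = begin
      weight o? (I ++ u ∷ R)        ≡⟨ weight-++ o? I (u ∷ R) ⟩
      weight o? I + (𝟙 (o? u) * ω u + weight o? R)
        ≡⟨ cong (λ k → weight o? I + (k * ω u + weight o? R)) (𝟙-no (o? u) (proj₁ bu)) ⟩
      weight o? I + weight o? R
        ≤⟨ +-mono-≤ (interval P I u R eq bu ¬bI) (suffix ((P ++ I) ++ [ u ]) [] R split []) ⟩
      weight g? I + weight g? R     ≤⟨ +-monoʳ-≤ (weight g? I) (m≤n+m _ (𝟙 (g? u) * ω u)) ⟩
      weight g? I + weight g? (u ∷ R) ≡⟨ weight-++ g? I (u ∷ R) ⟨
      weight g? (I ++ u ∷ R)        ∎
      where
      open ≤-Reasoning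
      split : M ≡ ((P ++ I) ++ [ u ]) ++ R
      split = trans eq (trans (sym (++-assoc P I (u ∷ R))) (sym (++-assoc (P ++ I) [ u ] R)))

    large : weight o? M ≤ weight g? M
    large = suffix [] [] M refl []

    module _ (tight : weight g? M ≤ weight o? M) where

      -- Tightness on the whole order and the inequality for the suffix behind `b` reverse the
      -- inequality on the prefix.
      prefix : ∀ P b R → M ≡ P ++ b ∷ R → weight g? (P ++ [ b ]) ≤ weight o? (P ++ [ b ])
      prefix P b R eq = +-cancelʳ-≤ (weight o? R) _ _ (begin
        weight g? (P ++ [ b ]) + weight o? R
          ≤⟨ +-monoʳ-≤ _ (suffix (P ++ [ b ]) [] R eq′ []) ⟩
        weight g? (P ++ [ b ]) + weight g? R
          ≡⟨ weight-++ g? (P ++ [ b ]) R ⟨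
        weight g? ((P ++ [ b ]) ++ R)
          ≡⟨ cong (weight g?) eq′ ⟨
        weight g? M  ≤⟨ tight ⟩
        weight o? M  ≡⟨ cong (weight o?) eq′ ⟩
        weight o? ((P ++ [ b ]) ++ R)
          ≡⟨ weight-++ o? (P ++ [ b ]) R ⟩
        weight o? (P ++ [ b ]) + weight o? R ∎)
        where
        open ≤-Reasoning
        eq′ : M ≡ (P ++ [ b ]) ++ R
        eq′ = trans eq (sym (++-assoc P [ b ] R))

      -- The reverse of `feedback`: under tightness, `b` loses nothing when it moves in front of the
      -- good vertices that precede it.
      bad-feedback : ∀ P b R → M ≡ P ++ b ∷ R → Bad b →
        weight (b ⇐?_) (filter good? P) ≤ weight (b ⇒?_) (filter good? P)
      bad-feedback P b R eq bb = begin
        weight (b ⇐?_) N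
          ≤⟨ weight-mono (b ⇐?_) g? N (λ z∈N → good-⇒bad bb (proj₂ (∈-filter⁻ good? {xs = P} z∈N))) ⟩
        weight g? N            ≤⟨ weight-filter-≤ g? good? P ⟩
        weight g? P            ≤⟨ m≤m+n _ _ ⟩
        weight g? P + weight g? [ b ] ≡⟨ weight-++ g? P [ b ] ⟨
        weight g? (P ++ [ b ]) ≤⟨ prefix P b R eq ⟩
        weight o? (P ++ [ b ]) ≡⟨ weight-++ o? P [ b ] ⟩
        weight o? P + (𝟙 (o? b) * ω b + 0)
          ≡⟨ cong (λ k → weight o? P + (k * ω b + 0)) (𝟙-no (o? b) (proj₁ bb)) ⟩
        weight o? P + 0        ≡⟨ +-identityʳ _ ⟩
        weight o? P            ≤⟨ weight-filter-⊆ o? good? (λ ou bu → proj₁ bu ou) P ⟩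
        weight o? N            ≤⟨ weight-mono o? (b ⇒?_) N (λ _ → bad⇒o bb) ⟩
        weight (b ⇒?_) N       ∎
        where
        open ≤-Reasoning
        N = filter good? P

      -- The bad vertices of `P` already stand at the front and are left out. The next bad vertex
      -- `u` jumps over the good vertices of `P`; from then on its contribution depends only on
      -- which vertices follow it, not on their order.
      sediment-suffix : ∀ P L → M ≡ P ++ L →
        forward (filter good? P ++ L) ≤ forward (filter bad? L ++ filter good? P ++ filter good? L)
      sediment-suffix P [] eq = ≤-refl
      sediment-suffix P (u ∷ L) eq
        with IH ← sediment-suffix (P ++ [ u ]) L (trans eq (sym (++-assoc P [ u ] L)))
        rewrite filter-++ good? P [ u ]
        with bad? u
      ... | no ¬bu rewrite ++-assoc (filter good? P) [ u ] L
                         | ++-assoc (filter good? P) [ u ] (filter good? L) = IH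
      ... | yes bu rewrite ++-identityʳ (filter good? P) = begin
        forward (N ++ u ∷ L)
          ≤⟨ +-cancelʳ-≤ (ω u * weight (u ⇐?_) N) _ _
               (≤-trans (+-monoʳ-≤ _ (*-monoʳ-≤ (ω u) (bad-feedback P u L eq bu)))
                        (≤-reflexive (sym (forward-move [] N u L)))) ⟩
        ω u * weight (u ⇒?_) (N ++ L) + forward (N ++ L)
          ≤⟨ +-monoʳ-≤ _ IH ⟩
        ω u * weight (u ⇒?_) (N ++ L) + forward (filter bad? L ++ N ++ filter good? L)
          ≡⟨ cong (λ k → ω u * k + forward (filter bad? L ++ N ++ filter good? L)) (∑-↭ _ perm) ⟩
        forward (u ∷ filter bad? L ++ N ++ filter good? L) ∎
        where
        open ≤-Reasoning
        N = filter good? P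
        perm : N ++ L ↭ filter bad? L ++ N ++ filter good? L
        perm = ↭-trans (++⁺ˡ N (↭-sym (sediment-↭ bad? L)))
               (↭-trans (↭-reflexive (sym (++-assoc N (filter bad? L) _)))
               (↭-trans (++⁺ʳ (filter good? L) (++-comm N (filter bad? L)))
                        (↭-reflexive (++-assoc (filter bad? L) N _))))

      sediment-forward : forward M ≤ forward (sediment bad? M)
      sediment-forward = sediment-suffix [] M refl

  -- Large vertices of the tournament.

  module Large {o : Rel A 0ℓ} (o? : Decidable₂ o) (o⇒ : ∀ {f u} → o f u → f ⇒ u) where

    Gained : List A → A → Pred A 0ℓ
    Gained S f u = ¬ o f u × Any (λ z → o f z × z ⇒ u) S

    gained? : ∀ S f → Decidable (Gained S f)
    gained? S f u = ¬? (o? f u) ×-dec any? (λ z → o? f z ×-dec (z ⇒? u)) S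

    IsLarge : List A → A → Set
    IsLarge S f = weight (o? f) S ≤ weight (gained? S f) S

    Large-↭ : ∀ {S M f} → S ↭ M → IsLarge S f → IsLarge M f
    Large-↭ {S} {M} {f} S↭M large = begin
      weight (o? f) M         ≡⟨ ∑-↭ _ S↭M ⟨
      weight (o? f) S         ≤⟨ large ⟩
      weight (gained? S f) S  ≤⟨ weight-mono (gained? S f) (gained? M f) S
                                    (λ _ (¬o , n) → ¬o , Any-resp-↭ S↭M n) ⟩
      weight (gained? M f) S  ≡⟨ ∑-↭ _ S↭M ⟩
      weight (gained? M f) M  ∎
      where open ≤-Reasoning

    module LastFeed (M Q : List A) (f : A) (M≡ : M ≡ Q ++ [ f ]) (med : IsMedian M)
      (ω>0 : ∀ {u} → u ∈ M → 0 < ω u) where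

      open DecMembership _≟_ using (_∈?_)

      -- `Feed` requires every out-neighbour of the chosen set to satisfy `n`, but `nM?` only sees
      -- in-neighbours in `M`; hence `o f` is restricted to `M`.
      oM? : Decidable (λ z → o f z × z ∈ M)
      oM? z = o? f z ×-dec (z ∈? M)

      nM? : Decidable (λ u → Any (λ z → o f z × z ⇒ u) M)
      nM? u = any? (λ z → o? f z ×-dec (z ⇒? u)) M

      oM⇒nM : ∀ {z u} → o f z × z ∈ M → z ⇒ u → Any (λ z → o f z × z ⇒ u) M
      oM⇒nM (oz , z∈M) z⇒u = lose z∈M (oz , z⇒u)

      f∉nM : ¬ Any (λ z → o f z × z ⇒ f) M
      f∉nM nf with _ , _ , oz , z⇒f ← find nf = asym z⇒f (o⇒ oz)

      module F = Feed M Q f M≡ med ω>0 oM? nM? oM⇒nM (o⇒ ∘ proj₁) f∉nM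

      o≤oM : weight (o? f) M ≤ weight oM? M
      o≤oM = weight-mono (o? f) oM? M (λ z∈M oz → oz , z∈M)

      gM≤g : weight F.g? M ≤ weight (gained? M f) M
      gM≤g = weight-mono F.g? (gained? M f) M (λ z∈M (¬o , n) → (λ oz → ¬o (oz , z∈M)) , n)

      large : IsLarge M f
      large = ≤-trans o≤oM (≤-trans F.large gM≤g)

      tight : weight (gained? M f) M ≤ weight (o? f) M → weight F.g? M ≤ weight oM? M
      tight le = ≤-trans gM≤g (≤-trans le o≤oM)

    median : ∀ S → ∃[ M ] (M ↭ S × IsMedian M)
    median S = let M , M↭ , max = maximal-permutation forward S
               in M , M↭ , λ L L↭ → max L (↭-trans L↭ M↭)

    -- `f` is the last vertex of a median order of `S` with `y` as late as possible. An additional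
    -- gain is required only if `o f x`. If the count in `S` is then tight, `y` is bad, since
    -- sedimentation would otherwise push it further back; so `y` is gained through `x`.
    second-large : ∀ {x y} S → x ⇒ y → ω x ≡ 1 → y ∈ S → (∀ {u} → u ∈ S → 0 < ω u) →
      ∃[ f ] (f ∈ S × IsLarge (x ∷ S) f)
    second-large {x} {y} S x⇒y ωx≡1 y∈S ω>0
      -- The factor `suc (length S)` exceeds every position, so `position y` only breaks ties
      -- between median orders.
      with M , M↭ , max ← maximal-permutation (λ L → forward L * suc (length S) + position y L) S
      with initLast M
    ... | [] = contradiction (∈-resp-↭ (↭-sym M↭) y∈S) λ ()
    ... | Q ∷ʳ′ f = f , ∈-resp-↭ M↭ f∈M , Large-↭ (prep x M↭) largeM
      where
      f∈M : f ∈ Q ++ [ f ]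
      f∈M = ∈-++⁺ʳ Q (here refl)

      M′ : List A
      M′ = Q ++ [ f ]

      μ : List A → ℕ
      μ L = forward L * suc (length S) + position y L

      μ-< : ∀ {L N} → forward L < forward N → position y L ≤ length S → μ L < μ N
      μ-< {L} {N} lt le = begin-strict
        forward L * suc (length S) + position y L  ≤⟨ +-monoʳ-≤ _ le ⟩
        forward L * suc (length S) + length S      <⟨ +-monoʳ-< (forward L * suc (length S)) ≤-refl ⟩
        forward L * suc (length S) + suc (length S) ≡⟨ +-comm (forward L * suc (length S)) _ ⟩
        suc (forward L) * suc (length S)           ≤⟨ *-monoˡ-≤ (suc (length S)) lt ⟩
        forward N * suc (length S)                 ≤⟨ m≤m+n _ _ ⟩
        μ N ∎
        where open ≤-Reasoning

      medM : IsMedian M′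
      medM L L↭ = ≮⇒≥ λ lt → <⇒≱
        (μ-< {M′} {L} lt (≤-trans (position≤length y M′) (≤-reflexive (↭-length M↭))))
        (max L (↭-trans L↭ M↭))

      open LastFeed M′ Q f refl medM (ω>0 ∘ ∈-resp-↭ M↭)

      gained-weaken : ∀ {u} → Gained M′ f u → Gained (x ∷ M′) f u
      gained-weaken (¬o , n) = ¬o , there n

      g≤g : weight (gained? M′ f) M′ ≤ weight (gained? (x ∷ M′) f) M′
      g≤g = weight-mono (gained? M′ f) (gained? (x ∷ M′) f) M′ (λ _ → gained-weaken)

      y∈M : y ∈ M′
      y∈M = ∈-resp-↭ (↭-sym M↭) y∈S

      g≤g′ : weight (gained? (x ∷ M′) f) M′ ≤ weight (gained? (x ∷ M′) f) (x ∷ M′)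
      g≤g′ = m≤n+m _ _

      largeM : IsLarge (x ∷ M′) f
      largeM = by-cases (o? f x)
        where
        open ≤-Reasoning
        gain : o f x → Dec (weight (o? f) M′ < weight (gained? M′ f) M′) →
               weight (o? f) M′ < weight (gained? (x ∷ M′) f) M′
        by-cases : Dec (o f x) → IsLarge (x ∷ M′) f
        by-cases (no ¬ofx) = begin
          𝟙 (o? f x) * ω x + weight (o? f) M′
            ≡⟨ cong (λ k → k * ω x + weight (o? f) M′) (𝟙-no (o? f x) ¬ofx) ⟩
          weight (o? f) M′                     ≤⟨ large ⟩
          weight (gained? M′ f) M′             ≤⟨ g≤g ⟩
          weight (gained? (x ∷ M′) f) M′       ≤⟨ g≤g′ ⟩
          weight (gained? (x ∷ M′) f) (x ∷ M′) ∎
        by-cases (yes ofx) = begin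
          𝟙 (o? f x) * ω x + weight (o? f) M′
            ≡⟨ cong₂ (λ k l → k * l + weight (o? f) M′) (𝟙-yes (o? f x) ofx) ωx≡1 ⟩
          suc (weight (o? f) M′)               ≤⟨ gain ofx (_ <? _) ⟩
          weight (gained? (x ∷ M′) f) M′       ≤⟨ g≤g′ ⟩
          weight (gained? (x ∷ M′) f) (x ∷ M′) ∎
        gain ofx (yes lt) = <-≤-trans lt g≤g
        gain ofx (no ≮) with F.bad? y
        ... | yes (¬oy , ¬ny) = ≤-<-trans large
          (weight-mono-< (gained? M′ f) (gained? (x ∷ M′) f) M′ gained-weaken y∈M (¬ny ∘ proj₂)
            ((λ oy → ¬oy (oy , y∈M)) , here (ofx , x⇒y)) (ω>0 y∈S))
        ... | no ¬by = contradiction (max (sediment F.bad? M′) (↭-trans (sediment-↭ F.bad? M′) M↭))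
          (<⇒≱ (+-mono-≤-< (*-monoˡ-≤ (suc (length S)) (F.sediment-forward (tight (≮⇒≥ ≮))))
                           (position-sediment F.bad? Q ¬by F.f-bad y∈Q)))
          where
          y∈Q : y ∈ Q
          y∈Q with ∈-++⁻ Q y∈M
          ... | inj₁ y∈Q         = y∈Q
          ... | inj₂ (here refl) = contradiction (o⇒ ofx) (asym x⇒y)

    -- `Special` will mark the contracted cycles. A large vertex of this kind stands for at least
    -- two vertices of the digraph, hence the first alternative. Any other last vertex `x` has
    -- weight 1 and is deleted for `second-large`.
    two-large : ∀ {Special : Pred A 0ℓ} → Decidable Special → ∀ S → Unique S → S ≢ [] →
      (∀ {u} → u ∈ S → 0 < ω u) →
      (∀ {u} → u ∈ S → ¬ Special u → ω u ≡ 1) →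
      (∀ {u} → u ∈ S → ¬ Special u → ∃[ v ] (v ∈ S × u ⇒ v)) →
      (∃[ f ] (f ∈ S × Special f × IsLarge S f)) ⊎
      (∃₂ λ f x → f ≢ x × f ∈ S × x ∈ S × IsLarge S f × IsLarge S x)
    two-large special? S unique nonempty ω>0 ω≡1 out
      with M , M↭ , med ← median S
      with initLast M
    ... | [] = contradiction (↭-empty-inv (↭-sym M↭)) nonempty
    ... | Q ∷ʳ′ x with special? x
    ... | yes sx = inj₁ (x , x∈S , sx , Large-↭ M↭ (LastFeed.large _ Q x refl med (ω>0 ∘ ∈-resp-↭ M↭)))
      where
      x∈S = ∈-resp-↭ M↭ (∈-++⁺ʳ Q (here refl))
    ... | no ¬sx = inj₂ (f , x , f≢x , ∈-resp-↭ xQ↭ (there f∈Q) , x∈S , Large-↭ xQ↭ f-large ,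
                         Large-↭ M↭ (LastFeed.large _ Q x refl med (ω>0 ∘ ∈-resp-↭ M↭)))
      where
      x∈S = ∈-resp-↭ M↭ (∈-++⁺ʳ Q (here refl))
      xQ↭ : x ∷ Q ↭ S
      xQ↭ = ↭-trans (↭-sym (++-comm Q [ x ])) M↭
      y = proj₁ (out x∈S ¬sx)
      x⇒y = proj₂ (proj₂ (out x∈S ¬sx))
      y∈Q : y ∈ Q
      y∈Q with ∈-resp-↭ (↭-sym xQ↭) (proj₁ (proj₂ (out x∈S ¬sx)))
      ... | here y≡x  = contradiction x⇒x (asym x⇒x)
        where x⇒x = subst (x ⇒_) y≡x x⇒y
      ... | there y∈Q = y∈Q
      second = second-large Q x⇒y (ω≡1 x∈S ¬sx) y∈Q (ω>0 ∘ ∈-resp-↭ xQ↭ ∘ there)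
      f = proj₁ second
      f∈Q = proj₁ (proj₂ second)
      f-large = proj₂ (proj₂ second)
      f≢x : f ≢ x
      f≢x f≡x with x≢Q ∷ _ ← Unique-resp-↭ (≡-setoid A) (↭⇒↭ₛ (↭-sym xQ↭)) unique =
        All.lookup x≢Q f∈Q (sym f≡x)

-- The dependency digraph of the missing edges

module _ {A : Set} (s : A → A) where

  fold-comm : ∀ x k → fold (s x) s k ≡ s (fold x s k)
  fold-comm x zero    = refl
  fold-comm x (suc k) = cong s (fold-comm x k)

  fold-period : ∀ {x d} → fold x s d ≡ x → ∀ m → fold x s (m * d) ≡ x
  fold-period eq zero = refl
  fold-period {x} {d} eq (suc m) =
    trans (fold-+ x s d) (trans (cong (λ y → fold y s d) (fold-period eq m)) eq)

-- Two of the first `suc n` iterates agree, and cancelling `s` step by step moves the coincidence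
-- back to `x`. Injectivity is asked only up to index `n`, which is as far as `bounded` in
-- `cyclic-nonroot` reaches.
eventually-periodic : ∀ {n} (s : Fin n → Fin n) x →
  (∀ {i j} → i ≤ n → j ≤ n → s (fold x s i) ≡ s (fold x s j) → fold x s i ≡ fold x s j) →
  ∃[ d ] (suc d ≤ n × fold x s (suc d) ≡ x)
eventually-periodic {n} s x inj
  with i , j , i<j , eq ← Fin.pigeonhole {n} {suc n} ≤-refl (fold x s ∘ toℕ) =
  d , ≤-trans (m≤n+m (suc d) (toℕ i)) (subst (_≤ n) (sym j≡) (≤-pred (Fin.toℕ<n j))) ,
  sym (cancel (toℕ i) (subst (_≤ n) (sym j≡) (≤-pred (Fin.toℕ<n j)))
    (trans eq (cong (fold x s) (sym j≡))))
  where
  d = toℕ j ∸ suc (toℕ i)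
  j≡ : toℕ i + suc d ≡ toℕ j
  j≡ = trans (+-suc (toℕ i) d) (m+[n∸m]≡n i<j)
  cancel : ∀ i → i + suc d ≤ n → fold x s i ≡ fold x s (i + suc d) → x ≡ fold x s (suc d)
  cancel zero    _  eq = eq
  cancel (suc i) le eq = cancel i (<⇒≤ le) (inj (≤-trans (m≤m+n i (suc d)) (<⇒≤ le)) (<⇒≤ le) eq)

module Structure {n : ℕ} (D : OrientedGraph n)
  (matching : OrientedGraph.MissingEdgesFormMatching D) where

  open OrientedGraph D

  V = Fin n

  Missing-sym : ∀ {x y} → MissingEdge x y → MissingEdge y x
  Missing-sym (x≢y , ¬xy , ¬yx) = x≢y ∘ sym , ¬yx , ¬xy

  abstract
    missing? : Decidable₂ MissingEdge
    missing? x y = ¬? (x Fin.≟ y) ×-dec ¬? (x ⟶? y) ×-dec ¬? (y ⟶? x)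

  adjacent : ∀ {x y} → x ≢ y → ¬ MissingEdge x y → x ⟶ y ⊎ y ⟶ x
  adjacent {x} {y} x≢y ¬m with x ⟶? y | y ⟶? x
  ... | yes xy | _      = inj₁ xy
  ... | no _   | yes yx = inj₂ yx
  ... | no ¬xy | no ¬yx = contradiction (x≢y , ¬xy , ¬yx) ¬m

  abstract
    -- The other end of the missing edge at x, or x itself if there is none.
    π : V → V
    π x with Fin.any? (missing? x)
    ... | yes (y , _) = y
    ... | no _        = x

    π-≡ : ∀ {x y} → MissingEdge x y → π x ≡ y
    π-≡ {x} m with Fin.any? (missing? x)
    ... | yes (_ , m′) = matching m′ m
    ... | no ¬m        = contradiction (_ , m) ¬m

  π-missing : ∀ {x y} → MissingEdge x y → MissingEdge x (π x)
  π-missing m = subst (MissingEdge _) (sym (π-≡ m)) m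

  abstract
    π-involutive : ∀ x → π (π x) ≡ x
    π-involutive x with Fin.any? (missing? x) in eq
    ... | yes (_ , m) = π-≡ (Missing-sym m)
    ... | no ¬m with Fin.any? (missing? x)
    ...   | yes m = contradiction m ¬m
    ...   | no _  = refl

  -- Blocked ends and predecessors of missing edges.

  TwoPath : V → V → Set
  TwoPath x y = ∃[ z ] (x ⟶ z × z ⟶ y)

  abstract
    twoPath? : Decidable₂ TwoPath
    twoPath? x y = Fin.any? λ z → (x ⟶? z) ×-dec (z ⟶? y)

  -- Orienting the missing edge at y towards y would create a
  -- second out-neighbour y of v that v does not have in D.
  infix 4 _⊳_
  _⊳_ : V → V → Set
  v ⊳ y = MissingEdge y (π y) × v ⟶ π y × y ⟶ v × ¬ TwoPath v y

  abstract
    _⊳?_ : Decidable₂ _⊳_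
    v ⊳? y = missing? y (π y) ×-dec (v ⟶? π y) ×-dec (y ⟶? v) ×-dec ¬? (twoPath? v y)

  -- An arc from `v` to `w` would continue to `y`, against `v ⊳ y`; an arc from `w` to `v` would
  -- continue to `π y`, against `w ⊳ π y`. So the vertices that block the two ends form a missing
  -- edge, the predecessor of the one at `y`.
  ⊳-missing : ∀ {v w y} → v ⊳ y → w ⊳ π y → MissingEdge v w
  ⊳-missing {v} {w} {y} (_ , vx , yv , ¬vy) (_ , wy , xw , ¬wx) rewrite π-involutive y =
    (λ { refl → no-digons yv wy }) , (λ vw → ¬vy (w , vw , wy)) , (λ wv → ¬wx (v , wv , vx))

  Blocked : V → Set
  Blocked y = ∃[ v ] v ⊳ y

  abstract
    blocked? : Decidable Blocked
    blocked? y = Fin.any? (_⊳? y)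

  -- By `⊳-missing`, a missing edge has a predecessor in the dependency digraph precisely when both
  -- its ends are blocked.
  Nonroot : V → Set
  Nonroot x = Blocked x × Blocked (π x)

  abstract
    nonroot? : Decidable Nonroot
    nonroot? x = blocked? x ×-dec blocked? (π x)

  nonroot-missing : ∀ {x} → Nonroot x → MissingEdge x (π x)
  nonroot-missing ((_ , m , _) , _) = m

  nonroot-π : ∀ {x} → Nonroot x → Nonroot (π x)
  nonroot-π {x} (b , b′) = b′ , subst Blocked (sym (π-involutive x)) b

  nonroot-π⁻ : ∀ {x} → Nonroot (π x) → Nonroot x
  nonroot-π⁻ {x} = subst Nonroot (π-involutive x) ∘ nonroot-π

  abstract
    -- Maps the ends of a missing edge to the ends of its predecessor. Roots are fixed, so that
    -- iteration stops there.
    θ : V → V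
    θ x with nonroot? x
    ... | yes (_ , v , _) = v
    ... | no _            = x

    θ-⊳ : ∀ {x} → Nonroot x → θ x ⊳ π x
    θ-⊳ {x} nr with nonroot? x
    ... | yes (_ , _ , v⊳) = v⊳
    ... | no ¬nr           = contradiction nr ¬nr

    θ-root : ∀ {x} → ¬ Nonroot x → θ x ≡ x
    θ-root {x} ¬nr with nonroot? x
    ... | yes nr = contradiction nr ¬nr
    ... | no _   = refl

  -- Some `w` blocks `x` as well, and by `⊳-missing` both `v` and `θ x` are the partner of `w`.
  θ-unique : ∀ {x v} → Nonroot x → v ⊳ π x → v ≡ θ x
  θ-unique {x} {v} nr@((w , w⊳x) , _) v⊳ =
    matching (Missing-sym (⊳-missing v⊳ w⊳)) (Missing-sym (⊳-missing (θ-⊳ nr) w⊳))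
    where
    w⊳ : w ⊳ π (π x)
    w⊳ = subst (w ⊳_) (sym (π-involutive x)) w⊳x

  θ⟶ : ∀ {x} → Nonroot x → θ x ⟶ x
  θ⟶ {x} nr with _ , e , _ ← θ-⊳ nr = subst (θ x ⟶_) (π-involutive x) e

  π⟶θ : ∀ {x} → Nonroot x → π x ⟶ θ x
  π⟶θ nr = proj₁ (proj₂ (proj₂ (θ-⊳ nr)))

  θ-noTwoPath : ∀ {x} → Nonroot x → ¬ TwoPath (θ x) (π x)
  θ-noTwoPath nr = proj₂ (proj₂ (proj₂ (θ-⊳ nr)))

  θ-missing : ∀ {x} → Nonroot x → MissingEdge (θ x) (θ (π x))
  θ-missing nr = ⊳-missing (θ-⊳ nr) (θ-⊳ (nonroot-π nr))

  π-θ : ∀ {x} → Nonroot x → π (θ x) ≡ θ (π x)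
  π-θ = π-≡ ∘ θ-missing

  θ-preserves-missing : ∀ {x y} → MissingEdge x y → MissingEdge (θ x) (θ y)
  θ-preserves-missing {x} m with refl ← π-≡ m | nonroot? x
  ... | yes nr = θ-missing nr
  ... | no ¬nr = subst₂ MissingEdge (sym (θ-root ¬nr)) (sym (θ-root (¬nr ∘ nonroot-π⁻))) m

  -- This is uniqueness of the successor. Otherwise `x` and `π y` are adjacent; `x ⟶ π y` gives a
  -- two-path from `θ y` to `π y`, and `π y ⟶ x` gives one from `θ (π x)` to `x`, both excluded.
  θ-injective : ∀ {x y} → Nonroot x → Nonroot y → θ x ≡ θ y → x ≡ y
  θ-injective {x} {y} nx ny eq with x Fin.≟ y
  ... | yes x≡y = x≡y
  ... | no x≢y with adjacent {x} {π y} x≢πy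
                    (λ m → x≢y (matching (Missing-sym m) (Missing-sym (nonroot-missing ny))))
    where
    x≢πy : x ≢ π y
    x≢πy refl = no-digons (π⟶θ ny) (subst (_⟶ x) eq (θ⟶ nx))
  ...   | inj₁ x⟶πy = contradiction (x , subst (_⟶ x) eq (θ⟶ nx) , x⟶πy) (θ-noTwoPath ny)
  ...   | inj₂ πy⟶x = contradiction
    (π y , θπx⟶πy , subst (π y ⟶_) (sym (π-involutive x)) πy⟶x) (θ-noTwoPath (nonroot-π nx))
    where
    θπx⟶πy : θ (π x) ⟶ π y
    θπx⟶πy = subst (_⟶ π y) (trans (sym (π-θ ny)) (trans (cong π (sym eq)) (π-θ nx)))
                    (θ⟶ (nonroot-π ny))

  -- Cycles of the dependency digraph.

  Cyclic : V → Set
  Cyclic x = Nonroot (fold x θ n)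

  abstract
    cyclic? : Decidable Cyclic
    cyclic? x = nonroot? (fold x θ n)

  fold-root : ∀ {x i} → ¬ Nonroot (fold x θ i) → ∀ k → fold x θ (k + i) ≡ fold x θ i
  fold-root ¬nr zero    = refl
  fold-root ¬nr (suc k) = trans (cong θ (fold-root ¬nr k)) (θ-root ¬nr)

  -- A root persists under `θ`, so none occurs among the iterates up to `n`. There `θ` is injective,
  -- which makes `x` periodic, and a later root would persist until `x` itself recurs.
  cyclic-nonroot : ∀ {x} → Cyclic x → ∀ i → Nonroot (fold x θ i)
  cyclic-nonroot {x} cx i with nonroot? (fold x θ i)
  ... | yes nr = nr
  ... | no ¬nr = contradiction (subst Nonroot x≡ (bounded z≤n)) ¬nr
    where
    bounded : ∀ {i} → i ≤ n → Nonroot (fold x θ i)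
    bounded {i} i≤n = decidable-stable (nonroot? _) λ ¬nr →
      ¬nr (subst Nonroot (trans (cong (fold x θ) (sym (m∸n+n≡m i≤n))) (fold-root ¬nr (n ∸ i))) cx)
    period : ∃[ d ] (suc d ≤ n × fold x θ (suc d) ≡ x)
    period = eventually-periodic θ x λ i≤n j≤n → θ-injective (bounded i≤n) (bounded j≤n)
    d = proj₁ period
    x≡ : x ≡ fold x θ i
    -- The index `i * suc d` is a multiple of the period and at least `i`, so the iterate there is
    -- both `x` and the root met at `i`.
    x≡ = trans (sym (fold-period θ (proj₂ (proj₂ period)) i))
         (trans (cong (fold x θ) (trans (*-suc i d) (+-comm i (i * d))))
                (fold-root ¬nr (i * d)))

  cyclic⇒nonroot : ∀ {x} → Cyclic x → Nonroot x
  cyclic⇒nonroot cx = cyclic-nonroot cx 0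

  cyclic-θ : ∀ {x} → Cyclic x → Cyclic (θ x)
  cyclic-θ {x} cx = subst Nonroot (sym (fold-comm θ x n)) (cyclic-nonroot cx (suc n))

  cyclic-θ⁻ : ∀ {x} → Cyclic (θ x) → Cyclic x
  cyclic-θ⁻ {x} cθx = decidable-stable (cyclic? x) λ ¬cx →
    ¬cx (subst Nonroot (trans (fold-comm θ x n) (θ-root ¬cx)) cθx)

  cyclic-π : ∀ {x} → Cyclic x → Cyclic (π x)
  cyclic-π {x} cx = subst Nonroot (sym (fold-π n)) (nonroot-π cx)
    where
    fold-π : ∀ i → fold (π x) θ i ≡ π (fold x θ i)
    fold-π zero    = refl
    fold-π (suc i) = trans (cong θ (fold-π i)) (sym (π-θ (cyclic-nonroot cx i)))

  cyclic-π⁻ : ∀ {x} → Cyclic (π x) → Cyclic x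
  cyclic-π⁻ {x} = subst Cyclic (π-involutive x) ∘ cyclic-π

  -- For cyclic `y`, the vertex `s y` blocks `y`: no two-path leads from `s y` back to `y`. The
  -- orbits of `s` on cyclic vertices will be the modules.
  s : V → V
  s y = θ (π y)

  cyclic-s : ∀ {y} → Cyclic y → Cyclic (s y)
  cyclic-s = cyclic-θ ∘ cyclic-π

  cyclic-s^ : ∀ {y} → Cyclic y → ∀ i → Cyclic (fold y s i)
  cyclic-s^ cy zero    = cy
  cyclic-s^ cy (suc i) = cyclic-s (cyclic-s^ cy i)

  π-injective : ∀ {x y} → π x ≡ π y → x ≡ y
  π-injective {x} {y} eq = trans (sym (π-involutive x)) (trans (cong π eq) (π-involutive y))

  ⟶s : ∀ {y} → Cyclic y → y ⟶ s y
  ⟶s {y} cy = subst (_⟶ s y) (π-involutive y) (π⟶θ (nonroot-π (cyclic⇒nonroot cy)))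

  -- An arc from `s y` to `z` would give the excluded two-path from `s y` through `z` to `y`.
  in-s : ∀ {y z} → Cyclic y → z ⟶ y → z ⟶ s y ⊎ z ≡ π (s y)
  in-s {y} {z} cy zy with missing? (s y) z
  ... | yes m = inj₂ (sym (π-≡ m))
  ... | no ¬m with adjacent {s y} {z} (λ { refl → no-digons zy (⟶s cy) }) ¬m
  ...   | inj₂ z⟶s = inj₁ z⟶s
  ...   | inj₁ s⟶z = contradiction (z , s⟶z , subst (z ⟶_) (sym (π-involutive y)) zy)
                       (θ-noTwoPath (nonroot-π (cyclic⇒nonroot cy)))

  s-period : ∀ {y} → Cyclic y → ∃[ d ] (suc d ≤ n × fold y s (suc d) ≡ y)
  s-period {y} cy = eventually-periodic s y λ {i} {j} _ _ eq →
    π-injective (θ-injective (nr i) (nr j) eq)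
    where
    nr : ∀ i → Nonroot (π (fold y s i))
    nr i = nonroot-π (cyclic⇒nonroot (cyclic-s^ cy i))

  -- Otherwise in-s would give y ⟶ sⁱ y for all i ≥ 1, which contradicts periodicity.
  π-in-orbit : ∀ {y} → Cyclic y → ∃[ i ] fold y s i ≡ π y
  π-in-orbit {y} cy with d , _ , eq ← s-period cy =
    [ (λ loop → contradiction (subst (y ⟶_) eq loop) (no-loops y)) , id ]′ (go d)
    where
    go : ∀ j → y ⟶ fold y s (suc j) ⊎ ∃[ i ] fold y s i ≡ π y
    go zero = inj₁ (⟶s cy)
    go (suc j) with go j
    ... | inj₂ found = inj₂ found
    ... | inj₁ y⟶ with in-s (cyclic-s^ cy (suc j)) y⟶
    ...   | inj₁ y⟶s = inj₁ y⟶s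
    ...   | inj₂ y≡  = inj₂ (suc (suc j) , trans (sym (π-involutive _)) (cong π (sym y≡)))

  -- Representatives of the cycles.

  least : V → ℕ → V
  least x zero    = x
  least x (suc k) with toℕ (least x k) ≤? toℕ (fold x s (suc k))
  ... | yes _ = least x k
  ... | no _  = fold x s (suc k)

  least-orbit : ∀ x k → ∃[ i ] least x k ≡ fold x s i
  least-orbit x zero = 0 , refl
  least-orbit x (suc k) with toℕ (least x k) ≤? toℕ (fold x s (suc k))
  ... | yes _ = least-orbit x k
  ... | no _  = suc k , refl

  least-≤ : ∀ x k {i} → i ≤ k → toℕ (least x k) ≤ toℕ (fold x s i)
  least-≤ x zero z≤n = ≤-refl
  least-≤ x (suc k) {i} i≤ with toℕ (least x k) ≤? toℕ (fold x s (suc k)) | m≤n⇒m<n∨m≡n i≤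
  ... | yes _ | inj₁ (s≤s i≤k) = least-≤ x k i≤k
  ... | yes le | inj₂ refl      = le
  ... | no ≰ | inj₁ (s≤s i≤k) = ≤-trans (<⇒≤ (≰⇒> ≰)) (least-≤ x k i≤k)
  ... | no _ | inj₂ refl      = ≤-refl

  abstract
    -- The contraction map: each orbit of `s` on cyclic vertices collapses to its smallest vertex.
    -- The fixed points are the vertices of the contracted tournament.
    rep : V → V
    rep x = if does (cyclic? x) then least x n else x

    rep-acyclic : ∀ {x} → ¬ Cyclic x → rep x ≡ x
    rep-acyclic {x} ¬cx = cong (if_then least x n else x) (dec-false (cyclic? x) ¬cx)

    rep-cyclic≡ : ∀ {x} → Cyclic x → rep x ≡ least x n
    rep-cyclic≡ {x} cx = cong (if_then least x n else x) (dec-true (cyclic? x) cx)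

  rep-orbit : ∀ x → Cyclic x → ∃[ i ] rep x ≡ fold x s i
  rep-orbit x cx = let i , eq = least-orbit x n in i , trans (rep-cyclic≡ cx) eq

  orbit-bounded : ∀ {x} → Cyclic x → ∀ i → ∃[ j ] (j ≤ n × fold x s i ≡ fold x s j)
  orbit-bounded {x} cx i =
    let j , j≤ , eq = reduce i in j , ≤-trans j≤ (proj₁ (proj₂ (s-period cx))) , eq
    where
    reduce : ∀ i → ∃[ j ] (j ≤ suc (proj₁ (s-period cx)) × fold x s i ≡ fold x s j)
    reduce zero = 0 , z≤n , refl
    reduce (suc i) with j , j≤ , eq ← reduce i with m≤n⇒m<n∨m≡n j≤
    ... | inj₁ j<   = suc j , j< , cong s eq
    -- Index `suc d` is `x` again, so the next iterate is `s x`, with index 1.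
    ... | inj₂ refl = 1 , s≤s z≤n , cong s (trans eq (proj₂ (proj₂ (s-period cx))))

  rep-≤ : ∀ {x} → Cyclic x → ∀ i → toℕ (rep x) ≤ toℕ (fold x s i)
  rep-≤ {x} cx i with j , j≤n , eq ← orbit-bounded cx i =
    subst₂ (λ r y → toℕ r ≤ toℕ y) (sym (rep-cyclic≡ cx)) (sym eq) (least-≤ x n j≤n)

  s-inverse : ∀ {x} → Cyclic x → ∃[ d ] fold (s x) s d ≡ x
  s-inverse {x} cx with d , _ , eq ← s-period cx = d , trans (fold-comm s x d) eq

  -- `x` and `s x` have the same orbit by periodicity, so each minimum bounds the other.
  rep-s : ∀ {x} → Cyclic x → rep (s x) ≡ rep x
  rep-s {x} cx = Fin.toℕ-injective (≤-antisym le ge)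
    where
    le : toℕ (rep (s x)) ≤ toℕ (rep x)
    le with i , eq ← rep-orbit x cx | d , eq′ ← s-inverse cx =
      subst (λ y → toℕ (rep (s x)) ≤ toℕ y)
        (trans (fold-+ (s x) s i) (trans (cong (λ y → fold y s i) eq′) (sym eq)))
        (rep-≤ (cyclic-s cx) (i + d))
    ge : toℕ (rep x) ≤ toℕ (rep (s x))
    ge with i , eq ← rep-orbit (s x) (cyclic-s cx) =
      subst (λ y → toℕ (rep x) ≤ toℕ y) (trans (sym (fold-comm s x i)) (sym eq)) (rep-≤ cx (suc i))

  rep-s^ : ∀ {x} → Cyclic x → ∀ i → rep (fold x s i) ≡ rep x
  rep-s^ cx zero    = refl
  rep-s^ cx (suc i) = trans (rep-s (cyclic-s^ cx i)) (rep-s^ cx i)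

  rep-π : ∀ {x} → Cyclic x → rep (π x) ≡ rep x
  rep-π {x} cx with i , eq ← π-in-orbit cx = trans (cong rep (sym eq)) (rep-s^ cx i)

  rep-cyclic : ∀ {x} → Cyclic x → Cyclic (rep x)
  rep-cyclic {x} cx with i , eq ← rep-orbit x cx = subst Cyclic (sym eq) (cyclic-s^ cx i)

  rep-cyclic⁻ : ∀ {x} → Cyclic (rep x) → Cyclic x
  rep-cyclic⁻ {x} crx = decidable-stable (cyclic? x) λ ¬cx → ¬cx (subst Cyclic (rep-acyclic ¬cx) crx)

  rep-idem : ∀ x → rep (rep x) ≡ rep x
  rep-idem x = go (cyclic? x)
    where
    go : Dec (Cyclic x) → rep (rep x) ≡ rep x
    go (no ¬cx) = cong rep (rep-acyclic ¬cx)
    go (yes cx) with i , eq ← rep-orbit x cx = trans (cong rep eq) (rep-s^ cx i)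

  orbit-sym : ∀ {x} → Cyclic x → ∀ i → ∃[ j ] fold (fold x s i) s j ≡ x
  orbit-sym cx zero = 0 , refl
  orbit-sym {x} cx (suc i)
    with j , eq ← orbit-sym cx i | d , eq′ ← s-inverse (cyclic-s^ cx i) =
    j + d , trans (fold-+ _ s j) (trans (cong (λ y → fold y s j) eq′) eq)

  same-orbit : ∀ {x y} → Cyclic x → Cyclic y → rep x ≡ rep y → ∃[ k ] fold x s k ≡ y
  same-orbit {x} {y} cx cy eq
    with i , eqx ← rep-orbit x cx | j , eqy ← rep-orbit y cy
    with k , eqk ← orbit-sym cy j =
    k + i , trans (fold-+ x s k) (trans (cong (λ z → fold z s k) (trans (sym eqx) (trans eq eqy))) eqk)

-- Comparison of the contracted tournament with D

module Transfer {n : ℕ} (D : OrientedGraph n)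
  (matching : OrientedGraph.MissingEdgesFormMatching D) where

  open OrientedGraph D

  open Structure D matching

  Second : V → V → Set
  Second v u = u ≢ v × ¬ v ⟶ u × TwoPath v u

  second? : Decidable₂ Second
  second? v u = ¬? (u Fin.≟ v) ×-dec ¬? (v ⟶? u) ×-dec twoPath? v u

  large-if : ∀ {v} → # (v ⟶?_) ≤ # (second? v) → LargeSecondNeighborhood v
  large-if {v} le = subst₂ _≤_ (sym (∣⟦⟧∣ (v ⟶?_))) (sym (∣⟦⟧∣ (isSecondOutNeighbor? v)))
    (≤-trans le (#-mono (second? v) (isSecondOutNeighbor? v) to))
    where
    to : ∀ {u} → Second v u → IsSecondOutNeighbor v u
    to {u} (u≢v , ¬vu , z , vz , zu) =
      (λ u∈ → [ u≢v ∘ x∈⁅y⁆⇒x≡y v , ¬vu ∘ ∈⟦⟧⁻ (v ⟶?_) ]′ (x∈p∪q⁻ _ (N⁺ v) u∈)) ,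
      z , x∈p∩q⁺ (∈⟦⟧⁺ (_⟶? u) zu , ∈⟦⟧⁺ (v ⟶?_) vz)

  has-out : ∀ {v} → ¬ Sink v → ∃[ u ] v ⟶ u
  has-out {v} ¬sink with Fin.any? (v ⟶?_)
  ... | yes out = out
  ... | no ¬out = contradiction
    (trans (∣⟦⟧∣ (v ⟶?_)) (trans
      (∑-cong (allFin n) (λ {u} _ → 𝟙-no (v ⟶? u) (¬out ∘ (u ,_)))) (∑-zero (allFin n))))
    ¬sink

  -- Cycles as modules.

  loop : ∀ {x y} → x ⟶ y → x ≢ y
  loop xy refl = no-loops _ xy

  -- `in-s` carries the arc from `z` around the orbit; its exception `z ≡ π (s y)` would put `z`
  -- into the class.
  class-in : ∀ {y y′ z} → z ⟶ y → rep z ≢ rep y → rep y ≡ rep y′ → z ⟶ y′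
  class-in {y} {y′} {z} zy z≁y y~y′ with cyclic? y
  ... | no ¬cy = subst (z ⟶_) y≡y′ zy
    where
    ¬cy′ : ¬ Cyclic y′
    ¬cy′ cy′ = ¬cy (rep-cyclic⁻ (subst Cyclic (sym y~y′) (rep-cyclic cy′)))
    y≡y′ : y ≡ y′
    y≡y′ = trans (sym (rep-acyclic ¬cy)) (trans y~y′ (rep-acyclic ¬cy′))
  ... | yes cy with k , eq ← same-orbit cy (rep-cyclic⁻ (subst Cyclic y~y′ (rep-cyclic cy))) y~y′ =
    subst (z ⟶_) eq (go k)
    where
    go : ∀ k → z ⟶ fold y s k
    go zero    = zy
    go (suc k) with in-s (cyclic-s^ cy k) (go k)
    ... | inj₁ z⟶ = z⟶
    ... | inj₂ z≡ = contradiction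
      (trans (cong rep z≡) (trans (rep-π (cyclic-s^ cy (suc k))) (rep-s^ cy (suc k)))) z≁y

  missing-class : ∀ {x y} → Cyclic x → MissingEdge x y → rep x ≡ rep y
  missing-class cx m = trans (sym (rep-π cx)) (cong rep (π-≡ m))

  class-acyclic : ∀ {x y} → ¬ Cyclic x → rep x ≡ rep y → x ≡ y
  class-acyclic {x} {y} ¬cx eq = trans (sym (rep-acyclic ¬cx)) (trans eq (rep-acyclic
    λ cy → ¬cx (rep-cyclic⁻ (subst Cyclic (sym eq) (rep-cyclic cy)))))

  -- An arc from `z` to `y′` would yield one from `z` to `y` by `class-in`.
  class-out : ∀ {y y′ z} → y ⟶ z → rep z ≢ rep y → rep y ≡ rep y′ → y′ ⟶ z
  class-out {y} {y′} {z} yz z≁y y~y′ with cyclic? y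
  ... | no ¬cy = subst (_⟶ z) (class-acyclic ¬cy y~y′) yz
  ... | yes cy with adjacent {y′} {z} (λ y′≡z → z≁y (trans (cong rep (sym y′≡z)) (sym y~y′)))
                      (λ m → z≁y (trans (sym (missing-class cy′ m)) (sym y~y′)))
    where
    cy′ : Cyclic y′
    cy′ = rep-cyclic⁻ (subst Cyclic y~y′ (rep-cyclic cy))
  ...   | inj₁ y′z = y′z
  ...   | inj₂ zy′ = contradiction
    (class-in zy′ (λ z~y′ → z≁y (trans z~y′ (sym y~y′))) (sym y~y′)) (no-digons yz)

  s-π : ∀ {y} → Cyclic y → s (π y) ≡ π (s y)
  s-π cy = sym (π-θ (nonroot-π (cyclic⇒nonroot cy)))

  -- `in-s` would carry both arcs around the orbit until they reach `z` itself. Its exception does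
  -- not occur, as `z` would then be an out-neighbour of `y` or of `π y`.
  not-dominating : ∀ {z u} → Cyclic u → rep u ≡ rep z → ¬ (z ⟶ u × z ⟶ π u)
  not-dominating {z} {u} cu u~z (zu , zπu)
    with k , eq ← same-orbit cu (rep-cyclic⁻ (subst Cyclic u~z (rep-cyclic cu))) u~z =
    no-loops z (subst (z ⟶_) eq (proj₁ (go k)))
    where
    step : ∀ {y} → Cyclic y → z ⟶ y × z ⟶ π y → z ⟶ s y × z ⟶ π (s y)
    step {y} cy (zy , zπy) with in-s cy zy | in-s (cyclic-π cy) zπy
    ... | inj₂ z≡ | _ = contradiction
      (subst (π y ⟶_) (trans (s-π cy) (sym z≡)) (⟶s (cyclic-π cy))) (no-digons zπy)
    ... | inj₁ _  | inj₂ z≡ = contradiction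
      (subst (y ⟶_) (sym (trans z≡ (trans (cong π (s-π cy)) (π-involutive (s y))))) (⟶s cy))
      (no-digons zy)
    ... | inj₁ zsy | inj₁ zsπy = zsy , subst (z ⟶_) (s-π cy) zsπy
    go : ∀ k → z ⟶ fold u s k × z ⟶ π (fold u s k)
    go zero    = zu , zπu
    go (suc k) = step (cyclic-s^ cu k) (go k)

  -- Blocked vertices come first, so a root missing edge is never oriented towards a blocked end.
  abstract
    key : V → ℕ
    key x = (if does (blocked? x) then 0 else n) + toℕ x

    key-blocked : ∀ {x} → Blocked x → key x ≡ toℕ x
    key-blocked {x} b = cong (λ d → (if d then 0 else n) + toℕ x) (dec-true (blocked? x) b)

    key-unblocked : ∀ {x} → ¬ Blocked x → key x ≡ n + toℕ x
    key-unblocked {x} ¬b = cong (λ d → (if d then 0 else n) + toℕ x) (dec-false (blocked? x) ¬b)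

  key-< : ∀ {x y} → Blocked x → ¬ Blocked y → key x < key y
  key-< {x} {y} b ¬b = subst₂ _<_ (sym (key-blocked b)) (sym (key-unblocked ¬b))
    (<-≤-trans (Fin.toℕ<n x) (m≤m+n n (toℕ y)))

  key-injective : ∀ {x y} → key x ≡ key y → x ≡ y
  key-injective {x} {y} eq with blocked? x | blocked? y
  ... | yes bx | yes by = Fin.toℕ-injective (trans (sym (key-blocked bx)) (trans eq (key-blocked by)))
  ... | no ¬bx | no ¬by =
    Fin.toℕ-injective (+-cancelˡ-≡ n _ _ (trans (sym (key-unblocked ¬bx)) (trans eq (key-unblocked ¬by))))
  ... | yes bx | no ¬by = contradiction eq (<⇒≢ (key-< bx ¬by))
  ... | no ¬bx | yes by = contradiction (sym eq) (<⇒≢ (key-< by ¬bx))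

  -- Orientation of the missing edges.

  root : V → V
  root x = fold x θ n

  root-missing : ∀ {x y} → MissingEdge x y → MissingEdge (root x) (root y)
  root-missing {x} {y} m = go n
    where
    go : ∀ i → MissingEdge (fold x θ i) (fold y θ i)
    go zero    = m
    go (suc i) = θ-preserves-missing (go i)

  root-θ : ∀ {x} → ¬ Cyclic x → root (θ x) ≡ root x
  root-θ {x} ¬cx = trans (fold-comm θ x n) (θ-root ¬cx)

  root-root : ∀ {x} → ¬ Nonroot x → root x ≡ x
  root-root {x} ¬nr = trans (cong (fold x θ) (sym (+-identityʳ n))) (fold-root {x} {0} ¬nr n)

  infix 4 _⇒_ _⇒?_
  -- The missing edges of a dependency path share their pair of roots, so one comparison of keys
  -- orients them all consistently. Missing edges on cycles disappear in the contraction.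
  _⇒_ : V → V → Set
  x ⇒ y = x ⟶ y ⊎ (MissingEdge x y × key (root x) < key (root y))

  _⇒?_ : Decidable₂ _⇒_
  x ⇒? y = (x ⟶? y) ⊎-dec (missing? x y ×-dec (key (root x) <? key (root y)))

  ⇒-asym : Asymmetric _⇒_
  ⇒-asym (inj₁ xy) (inj₁ yx) = no-digons xy yx
  ⇒-asym (inj₁ xy) (inj₂ ((_ , _ , ¬xy) , _)) = ¬xy xy
  ⇒-asym (inj₂ ((_ , _ , ¬yx) , _)) (inj₁ yx) = ¬yx yx
  ⇒-asym (inj₂ (_ , lt)) (inj₂ (_ , gt)) = <-asym lt gt

  ⇒-connex : ∀ {x y} → x ≢ y → x ⇒ y ⊎ y ⇒ x
  ⇒-connex {x} {y} x≢y with missing? x y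
  ... | no ¬m = [ inj₁ ∘ inj₁ , inj₂ ∘ inj₁ ]′ (adjacent x≢y ¬m)
  ... | yes m with <-cmp (key (root x)) (key (root y))
  ...   | tri< lt _ _ = inj₁ (inj₂ (m , lt))
  ...   | tri> _ _ gt = inj₂ (inj₂ (Missing-sym m , gt))
  ...   | tri≈ _ eq _ = contradiction (key-injective eq) (proj₁ (root-missing m))

  -- If `z` is not a root, `θ-unique` identifies `f`, and the missing edge at `f` has the same roots
  -- in the same order. If `z` is a root, `u` is blocked by `f`, so the choice of `key` makes `z`
  -- blocked too, a contradiction.
  orientation : ∀ {f z u} → MissingEdge z u → ¬ Cyclic z → z ⇒ u → f ⊳ u →
                Nonroot z × f ≡ θ z × f ⇒ π f
  orientation m _ (inj₁ zu) _ = contradiction zu (proj₁ (proj₂ m))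
  orientation {f} {z} m ¬cz (inj₂ (_ , lt)) f⊳u with refl ← π-≡ m with nonroot? z
  ... | yes nr with refl ← θ-unique nr f⊳u =
    nr , refl , inj₂ (subst (MissingEdge f) (sym (π-θ nr)) (θ-missing nr) ,
      subst₂ (λ a b → key a < key b) (sym (root-θ ¬cz))
        (trans (sym (root-θ (¬cz ∘ cyclic-π⁻))) (cong root (sym (π-θ nr)))) lt)
  ... | no ¬nr = contradiction (decidable-stable (blocked? z) ¬¬bz , f , f⊳u) ¬nr
    where
    lt′ : key z < key (π z)
    lt′ = subst₂ (λ a b → key a < key b) (root-root ¬nr) (root-root (¬nr ∘ nonroot-π⁻)) lt
    ¬¬bz : ¬ ¬ Blocked z
    ¬¬bz ¬bz = <-asym lt′ (key-< (f , f⊳u) ¬bz)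

  -- If f is not of the form θ a, the missing edge at f may be reversed towards f without affecting
  -- any other vertex, so we do not count it as leaving f.
  o : V → V → Set
  o f u = f ⟶ u ⊎ (MissingEdge f u × f ⇒ u × ∃[ a ] (Nonroot a × θ a ≡ f))

  o? : Decidable₂ o
  o? f u = (f ⟶? u) ⊎-dec
    (missing? f u ×-dec (f ⇒? u) ×-dec Fin.any? (λ a → nonroot? a ×-dec (θ a Fin.≟ f)))

  o⇒ : ∀ {f u} → o f u → f ⇒ u
  o⇒ (inj₁ fu)            = inj₁ fu
  o⇒ (inj₂ (_ , f⇒u , _)) = f⇒u

  -- Weights in the contraction.

  ω : V → ℕ
  ω v = # (λ u → rep u Fin.≟ v)

  rep-fixed? : Decidable (λ v → rep v ≡ v)
  rep-fixed? v = rep v Fin.≟ v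

  S : List V
  S = filter rep-fixed? (allFin n)

  rep∈S : ∀ u → rep u ∈ S
  rep∈S u = ∈-filter⁺ rep-fixed? (∈-allFin (rep u)) (rep-idem u)

  S-fixed : ∀ {v} → v ∈ S → rep v ≡ v
  S-fixed = proj₂ ∘ ∈-filter⁻ rep-fixed? {xs = allFin n}

  ω>0 : ∀ {u} → u ∈ S → 0 < ω u
  ω>0 {u} u∈S = ≤-trans (≤-reflexive (sym (#-singleton u)))
    (#-mono (u Fin.≟_) (λ v → rep v Fin.≟ u) (λ { refl → S-fixed u∈S }))

  ω≡1 : ∀ {u} → u ∈ S → ¬ Cyclic u → ω u ≡ 1
  ω≡1 {u} u∈S ¬cu = ≤-antisym
    (≤-trans (#-mono (λ v → rep v Fin.≟ u) (u Fin.≟_)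
              (λ {v} eq → class-acyclic ¬cu (trans (S-fixed u∈S) (sym eq))))
             (≤-reflexive (#-singleton u)))
    (ω>0 u∈S)

  open WeightedTournament Fin._≟_ _⇒_ _⇒?_ ⇒-asym ⇒-connex ω
  open Large o? o⇒

  -- Translates weights into cardinalities in `D`: after exchanging the sums, each vertex `u` is
  -- counted once, at `rep u`.
  weight-S : ∀ {p : Pred V 0ℓ} (p? : Decidable p) → weight p? S ≡ # (p? ∘ rep)
  weight-S p? = begin-equality
    ∑ (λ v → 𝟙 (p? v) * ω v) S
      ≡⟨ ∑-cong S (λ {v} _ → sym (∑-*ˡ (𝟙 (p? v)) _ (allFin n))) ⟩
    ∑ (λ v → ∑ (λ u → 𝟙 (p? v) * 𝟙 (rep u Fin.≟ v)) (allFin n)) S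
      ≡⟨ ∑-swap _ S (allFin n) ⟩
    ∑ (λ u → ∑ (λ v → 𝟙 (p? v) * 𝟙 (rep u Fin.≟ v)) S) (allFin n)
      ≡⟨ ∑-cong (allFin n) (λ {u} _ →
           ∑-δ Fin._≟_ (𝟙 ∘ p?) S (filter⁺ rep-fixed? (allFin⁺ n)) (rep∈S u)) ⟩
    # (p? ∘ rep) ∎
    where open ≤-Reasoning

  count-large : ∀ {f} → IsLarge S f → # (o? f ∘ rep) ≤ # (gained? S f ∘ rep)
  count-large {f} = subst₂ _≤_ (weight-S (o? f)) (weight-S (gained? S f))

  -- An arc of `D` into `rep u` also enters `u`, by `class-in`. An oriented missing edge has no
  -- cyclic end here, since missing edges at cyclic vertices stay inside a class.
  second-path : ∀ {f z u} → f ⟶ z → rep z ≡ z → z ⇒ rep u → ¬ f ⟶ u → u ≢ f →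
    TwoPath f u ⊎ (¬ Cyclic z × MissingEdge z u × z ⇒ u × f ⊳ u)
  second-path {f} {z} {u} fz zz z⇒ru ¬fu u≢f = by-arc z⇒ru
    where
    z≁u : rep z ≢ rep u
    z≁u z~u = ⇒-asym z⇒z z⇒z
      where
      z⇒z : z ⇒ z
      z⇒z = subst (z ⇒_) (trans (sym z~u) zz) z⇒ru
    by-arc : z ⇒ rep u → TwoPath f u ⊎ (¬ Cyclic z × MissingEdge z u × z ⇒ u × f ⊳ u)
    by-arc (inj₁ zru) = inj₁ (z , fz , class-in zru (λ z~ → z≁u (trans z~ (rep-idem u))) (rep-idem u))
    by-arc (inj₂ (m , _)) with twoPath? f u
    ... | yes path = inj₁ path
    ... | no ¬path = inj₂
      (¬cz , mzu , subst (z ⇒_) ru≡u z⇒ru , muz , subst (f ⟶_) (sym πu≡z) fz , uf , ¬path)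
      where
      ¬cz : ¬ Cyclic z
      ¬cz cz = z≁u (trans (missing-class cz m) (rep-idem u))
      ¬cu : ¬ Cyclic u
      ¬cu cu = z≁u (trans (sym (missing-class (rep-cyclic cu) (Missing-sym m))) (rep-idem u))
      ru≡u = rep-acyclic ¬cu
      mzu : MissingEdge z u
      mzu = subst (MissingEdge z) ru≡u m
      πu≡z : π u ≡ z
      πu≡z = π-≡ (Missing-sym mzu)
      muz : MissingEdge u (π u)
      muz = π-missing (Missing-sym mzu)
      uf : u ⟶ f
      uf with adjacent {u} {f} u≢f (λ m′ → loop fz (matching m′ (Missing-sym mzu)))
      ... | inj₁ uf = uf
      ... | inj₂ fu = contradiction fu ¬fu

  -- Vertices outside the cycles.

  module Acyclic {f} (f∈S : f ∈ S) (¬cf : ¬ Cyclic f) where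

    f-fixed = S-fixed f∈S

    out-rep : ∀ {u} → f ⟶ u → f ⟶ rep u
    out-rep {u} fu = class-in fu (λ f~u → loop fu (class-acyclic ¬cf f~u)) (sym (rep-idem u))

    ¬out : ∀ {u} → ¬ o f (rep u) → ¬ f ⟶ u
    ¬out ¬o fu = ¬o (inj₁ (out-rep fu))

    not-f : ∀ {u z} → o f z → z ⇒ rep u → u ≢ f
    not-f oz z⇒ refl = ⇒-asym (o⇒ oz) (subst (_ ⇒_) f-fixed z⇒)

    E : Set
    E = MissingEdge f (π f) × f ⇒ π f × ∃[ a ] (Nonroot a × θ a ≡ f)

    E? : Dec E
    E? = missing? f (π f) ×-dec (f ⇒? π f) ×-dec Fin.any? (λ a → nonroot? a ×-dec (θ a Fin.≟ f))

    -- Without `E`, `o f` is the out-neighbourhood of `f` in `D`. A gained vertex that is no second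
    -- neighbour in `D` would, by `orientation`, witness `E` with `z` as `a`.
    large-¬E : ¬ E → IsLarge S f → # (f ⟶?_) ≤ # (second? f)
    large-¬E ¬E large = ≤-trans (#-mono (f ⟶?_) (o? f ∘ rep) (inj₁ ∘ out-rep))
      (≤-trans (count-large large) (#-mono (gained? S f ∘ rep) (second? f) gain))
      where
      o⟶ : ∀ {z} → o f z → f ⟶ z
      o⟶ (inj₁ fz)             = fz
      o⟶ (inj₂ (m , f⇒z , a)) = contradiction (π-missing m , subst (f ⇒_) (sym (π-≡ m)) f⇒z , a) ¬E
      gain : ∀ {u} → Gained S f (rep u) → Second f u
      gain (¬o , n) with z , z∈S , oz , z⇒ ← find n
        with second-path (o⟶ oz) (S-fixed z∈S) z⇒ (¬out ¬o) (not-f oz z⇒)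
      ... | inj₁ path = not-f oz z⇒ , ¬out ¬o , path
      ... | inj₂ (¬cz , m , z⇒u , f⊳u) with nr , f≡θz , f⇒πf ← orientation m ¬cz z⇒u f⊳u =
        contradiction
          (subst (λ f → MissingEdge f (π f)) (sym f≡θz) (π-missing (θ-missing nr)) , f⇒πf , z , nr , sym f≡θz) ¬E

    -- The arc f ⇒ π f adds one out-neighbour of f and the single vertex π a to its
    -- second out-neighbours.
    large-E : E → IsLarge S f → # (f ⟶?_) ≤ # (second? f)
    large-E (m , f⇒πf , a , na , θa≡f) large = +-cancelʳ-≤ 1 _ _ (begin
      # (f ⟶?_) + 1
        ≡⟨ cong (# (f ⟶?_) +_) (#-singleton (π f)) ⟨
      # (f ⟶?_) + # (π f Fin.≟_)
        ≡⟨ ∑-+ _ _ (allFin n) ⟨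
      ∑ (λ u → 𝟙 (f ⟶? u) + 𝟙 (π f Fin.≟ u)) (allFin n)
        ≤⟨ ∑-mono (allFin n) (λ {u} _ → lower u) ⟩
      # (o? f ∘ rep)
        ≤⟨ count-large large ⟩
      # (gained? S f ∘ rep)
        ≤⟨ ∑-mono (allFin n) (λ {u} _ → upper u) ⟩
      ∑ (λ u → 𝟙 (second? f u) + 𝟙 (π a Fin.≟ u)) (allFin n)
        ≡⟨ ∑-+ _ _ (allFin n) ⟩
      # (second? f) + # (π a Fin.≟_)
        ≡⟨ cong (# (second? f) +_) (#-singleton (π a)) ⟩
      # (second? f) + 1 ∎)
      where
      open ≤-Reasoning
      oπf : o f (rep (π f))
      oπf = subst (o f) (sym (rep-acyclic (¬cf ∘ cyclic-π⁻))) (inj₂ (m , f⇒πf , a , na , θa≡f))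

      lower : ∀ u → 𝟙 (f ⟶? u) + 𝟙 (π f Fin.≟ u) ≤ 𝟙 (o? f (rep u))
      lower u with π f Fin.≟ u
      ... | no _ = ≤-trans (≤-reflexive (+-identityʳ _))
                     (𝟙-mono (f ⟶? u) (o? f (rep u)) (inj₁ ∘ out-rep))
      ... | yes refl rewrite 𝟙-no (f ⟶? π f) (proj₁ (proj₂ m)) | 𝟙-yes (o? f (rep (π f))) oπf = ≤-refl

      gain : ∀ {u} → π a ≢ u → Gained S f (rep u) → Second f u
      gain {u} πa≢u (¬o , n) with z , z∈S , oz , z⇒ ← find n = u≢f , ¬fu , path oz
        where
        u≢f = not-f oz z⇒
        ¬fu = ¬out ¬o
        fa : f ⟶ a
        fa = subst (_⟶ a) θa≡f (θ⟶ na)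
        u-via-πf : z ≡ π f → TwoPath f u
        -- `f ⟶ a` because `f` is `θ a`. An arc from `u` to `a` would complete a two-path from
        -- `π f`, which is `θ (π a)`, to `a`; so `a ⟶ u`.
        u-via-πf z≡πf with adjacent {u} {a} (λ { refl → ¬fu fa }) (λ m′ → πa≢u (π-≡ (Missing-sym m′)))
        ... | inj₂ au = a , fa , au
        ... | inj₁ ua = contradiction
          (u , subst (_⟶ u) z≡θπa (zu z⇒) , subst (u ⟶_) (sym (π-involutive a)) ua)
          (θ-noTwoPath (nonroot-π na))
          where
          z≡θπa : z ≡ θ (π a)
          z≡θπa = trans z≡πf (trans (cong π (sym θa≡f)) (π-θ na))
          zu : z ⇒ rep u → z ⟶ u
          zu (inj₁ zru) = class-in zru
            (λ z~ → loop zru (trans (sym (S-fixed z∈S)) (trans z~ (rep-idem u)))) (rep-idem u)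
          zu (inj₂ (m′ , _)) = contradiction
            (sym (class-acyclic ¬cf (trans f-fixed
              (matching (subst (λ z → MissingEdge z f) (sym z≡πf) (Missing-sym m)) m′)))) u≢f
        path : o f z → TwoPath f u
        path (inj₂ (m′ , _)) = u-via-πf (sym (π-≡ m′))
        path (inj₁ fz) with second-path fz (S-fixed z∈S) z⇒ ¬fu u≢f
        ... | inj₁ p = p
        -- Here `θ z` and `θ a` are both `f`, so `z` is `a` and `u` is the excluded vertex `π a`.
        ... | inj₂ (¬cz , m′ , z⇒u , f⊳u) with nr , f≡θz , _ ← orientation m′ ¬cz z⇒u f⊳u =
          contradiction (trans (cong π (θ-injective na nr (trans θa≡f f≡θz))) (π-≡ m′)) πa≢u

      upper : ∀ u → 𝟙 (gained? S f (rep u)) ≤ 𝟙 (second? f u) + 𝟙 (π a Fin.≟ u)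
      upper u with π a Fin.≟ u
      ... | yes _ = ≤-trans (𝟙≤1 (gained? S f (rep u))) (m≤n+m 1 _)
      ... | no πa≢u = ≤-trans (𝟙-mono (gained? S f (rep u)) (second? f u) (gain πa≢u)) (m≤m+n _ 0)

    transfer : IsLarge S f → LargeSecondNeighborhood f
    transfer large with E?
    ... | yes e = large-if (large-E e large)
    ... | no ¬e = large-if (large-¬E ¬e large)

  -- Vertices on the cycles.

  module CyclicClass {f} (f∈S : f ∈ S) (cf : Cyclic f) (large : IsLarge S f)
                {x} (x~f : rep x ≡ f) where

    f-fixed = S-fixed f∈S

    cx : Cyclic x
    cx = rep-cyclic⁻ (subst Cyclic (sym x~f) cf)

    Inside : V → Set
    Inside u = rep u ≡ f

    inside? : Decidable Inside
    inside? u = rep u Fin.≟ f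

    outside-≢ : ∀ {u} → ¬ Inside u → rep u ≢ rep x
    outside-≢ u∉ u~x = u∉ (trans u~x x~f)

    x~rf : rep x ≡ rep f
    x~rf = trans x~f (sym f-fixed)

    x⟶⇒f⟶ : ∀ {u} → ¬ Inside u → x ⟶ u → f ⟶ u
    x⟶⇒f⟶ u∉ xu = class-out xu (outside-≢ u∉) x~rf

    f⟶⇒x⟶ : ∀ {u} → ¬ Inside u → f ⟶ u → x ⟶ u
    f⟶⇒x⟶ u∉ fu = class-out fu (λ u~f → u∉ (trans u~f f-fixed)) (sym x~rf)

    out-rep : ∀ {u} → ¬ Inside u → f ⟶ u → f ⟶ rep u
    out-rep {u} u∉ fu = class-in fu (λ f~u → u∉ (trans (sym f~u) f-fixed)) (sym (rep-idem u))

    -- The arcs between the class and the rest are the same for `x` and `f`. Oriented missing edges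
    -- contribute nothing new: `f ≡ θ z` would make `z` cyclic.
    outside-gain : ∀ {u} → Gained S f (rep u) → Second x u × ¬ Inside u
    outside-gain {u} (¬o , n) with z , z∈S , oz , z⇒ ← find n =
      (u≢x , ¬fu ∘ x⟶⇒f⟶ u∉ , to-x path) , u∉
      where
      u∉ : ¬ Inside u
      u∉ ru≡f = ⇒-asym (o⇒ oz) (subst (z ⇒_) ru≡f z⇒)
      u≢x : u ≢ x
      u≢x refl = u∉ x~f
      ¬fu : ¬ f ⟶ u
      ¬fu fu = ¬o (inj₁ (out-rep u∉ fu))
      fz : f ⟶ z
      fz = arc oz
        where
        arc : o f z → f ⟶ z
        arc (inj₁ fz) = fz
        arc (inj₂ (m , _)) = contradiction
          (trans (sym f-fixed) (trans (missing-class cf m) (S-fixed z∈S))) (proj₁ m)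
      path : TwoPath f u
      path with second-path fz (S-fixed z∈S) z⇒ ¬fu (λ { refl → u∉ f-fixed })
      ... | inj₁ p = p
      ... | inj₂ (¬cz , m , z⇒u , f⊳u) with _ , f≡θz , _ ← orientation m ¬cz z⇒u f⊳u =
        contradiction (cyclic-θ⁻ (subst Cyclic f≡θz cf)) ¬cz
      to-x : TwoPath f u → TwoPath x u
      to-x (y , fy , yu) = y , f⟶⇒x⟶ y∉ fy , yu
        where
        y∉ : ¬ Inside y
        y∉ ry≡f = ¬fu (class-out yu (λ u~y → u∉ (trans u~y ry≡f)) (trans ry≡f (sym f-fixed)))

    outside : # (λ u → (x ⟶? u) ×-dec ¬? (inside? u)) ≤ # (λ u → second? x u ×-dec ¬? (inside? u))
    outside = ≤-trans
      (#-mono (λ u → (x ⟶? u) ×-dec ¬? (inside? u)) (o? f ∘ rep)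
        (λ (xu , u∉) → inj₁ (out-rep u∉ (x⟶⇒f⟶ u∉ xu))))
      (≤-trans (count-large large)
        (#-mono (gained? S f ∘ rep) (λ u → second? x u ×-dec ¬? (inside? u)) outside-gain))

    -- On the class of x, exactly one vertex of each missing edge avoiding x is an out-neighbour
    -- of x, and the other one is a second out-neighbour unless it is s⁻¹ x; then π x is used instead.
    φ : V → V
    φ u with θ u Fin.≟ x
    ... | yes _ = π x
    ... | no _  = π u

    φ-special : ∀ {u} → θ u ≡ x → φ u ≡ π x
    φ-special {u} eq with θ u Fin.≟ x
    ... | yes _ = refl
    ... | no ≢  = contradiction eq ≢

    φ-generic : ∀ {u} → θ u ≢ x → φ u ≡ π u
    φ-generic {u} ≢ with θ u Fin.≟ x
    ... | yes eq = contradiction eq ≢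
    ... | no _   = refl

    inside-cyclic : ∀ {u} → Inside u → Cyclic u
    inside-cyclic u∈ = rep-cyclic⁻ (subst Cyclic (sym u∈) cf)

    x-missing : MissingEdge x (π x)
    x-missing = nonroot-missing (cyclic⇒nonroot cx)

    θπ⟶π : ∀ {u} → Cyclic u → θ (π u) ⟶ π u
    θπ⟶π cu = θ⟶ (nonroot-π (cyclic⇒nonroot cu))

    π-θ′ : ∀ {u} → Cyclic u → π (s u) ≡ θ u
    π-θ′ {u} cu = trans (sym (s-π cu)) (cong θ (π-involutive u))

    φ-second : ∀ {u} → x ⟶ u × Inside u → Second x (φ u) × Inside (φ u)
    φ-second {u} (xu , u∈) = by-cases (θ u Fin.≟ x)
      where
      cu : Cyclic u
      cu = inside-cyclic u∈
      by-cases : Dec (θ u ≡ x) → Second x (φ u) × Inside (φ u)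
      -- Here `s u` is `π (θ u)`, that is, `π x`, so the path runs through `u` itself.
      by-cases (yes θu≡x) rewrite φ-special θu≡x =
        (proj₁ x-missing ∘ sym , proj₁ (proj₂ x-missing) , u , xu , uπx) , trans (rep-π cx) x~f
        where
        uπx : u ⟶ π x
        uπx = subst (u ⟶_) (trans (sym (π-θ (cyclic⇒nonroot cu))) (cong π θu≡x)) (⟶s cu)
      -- The path runs through `s u`: the exception in `in-s` would give `x ≡ π (s u)`, which equals
      -- `θ u`.
      by-cases (no θu≢x) rewrite φ-generic θu≢x =
        (πu≢x , (λ xπu → not-dominating cu (trans u∈ (sym x~f)) (xu , xπu)) , s u , xs , θπ⟶π cu) ,
        trans (rep-π cu) u∈
        where
        πu≢x : π u ≢ x
        πu≢x πu≡x = proj₂ (proj₂ (subst (MissingEdge u) πu≡x (nonroot-missing (cyclic⇒nonroot cu)))) xu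
        xs : x ⟶ s u
        xs with in-s cu xu
        ... | inj₁ xs = xs
        ... | inj₂ x≡ = contradiction (sym (trans x≡ (π-θ′ cu))) θu≢x

    φ-injective : ∀ {u v} → x ⟶ u × Inside u → x ⟶ v × Inside v → φ u ≡ φ v → u ≡ v
    φ-injective {u} {v} (xu , u∈) (xv , v∈) eq with θ u Fin.≟ x | θ v Fin.≟ x
    ... | yes θu | yes θv =
      θ-injective (cyclic⇒nonroot (inside-cyclic u∈)) (cyclic⇒nonroot (inside-cyclic v∈)) (trans θu (sym θv))
    ... | no _   | no _   = π-injective eq
    ... | yes _  | no _   = contradiction (π-injective eq) (loop xv)
    ... | no _   | yes _  = contradiction (sym (π-injective eq)) (loop xu)

    inside : # (λ u → (x ⟶? u) ×-dec inside? u) ≤ # (λ u → second? x u ×-dec inside? u)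
    inside = #-injection (λ u → (x ⟶? u) ×-dec inside? u) (λ u → second? x u ×-dec inside? u)
                         φ φ-second φ-injective

    transfer : LargeSecondNeighborhood x
    transfer = large-if (begin
      # (x ⟶?_)       ≡⟨ #-split (x ⟶?_) inside? ⟩
      _               ≤⟨ +-mono-≤ inside outside ⟩
      _               ≡⟨ #-split (second? x) inside? ⟨
      # (second? x)   ∎)
      where open ≤-Reasoning

  -- Two vertices with large second neighborhoods.

  both-large : ∀ {f} → f ∈ S → Cyclic f → IsLarge S f →
    ∃₂ λ u v → u ≢ v × LargeSecondNeighborhood u × LargeSecondNeighborhood v
  both-large {f} f∈S cf large =
    f , π f , proj₁ (nonroot-missing (cyclic⇒nonroot cf)) ,
    CyclicClass.transfer f∈S cf large (S-fixed f∈S) ,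
    CyclicClass.transfer f∈S cf large (trans (rep-π cf) (S-fixed f∈S))

  two-large-second : V → (∀ v → ¬ Sink v) →
    ∃₂ λ u v → u ≢ v × LargeSecondNeighborhood u × LargeSecondNeighborhood v
  two-large-second v₀ no-sink
    with two-large cyclic? S (filter⁺ rep-fixed? (allFin⁺ n)) S≢[] ω>0 ω≡1 out
    where
    S≢[] : S ≢ []
    S≢[] eq with () ← subst (rep v₀ ∈_) eq (rep∈S v₀)
    out : ∀ {u} → u ∈ S → ¬ Cyclic u → ∃[ v ] (v ∈ S × u ⇒ v)
    out {u} u∈S ¬cu with v , uv ← has-out (no-sink u) =
      rep v , rep∈S v , inj₁ (Acyclic.out-rep u∈S ¬cu uv)
  ... | inj₁ (f , f∈S , cf , large) = both-large f∈S cf large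
  ... | inj₂ (f , x , f≢x , f∈S , x∈S , f-large , x-large) with cyclic? f | cyclic? x
  ...   | yes cf | _      = both-large f∈S cf f-large
  ...   | no _   | yes cx = both-large x∈S cx x-large
  ...   | no ¬cf | no ¬cx =
    f , x , f≢x , Acyclic.transfer f∈S ¬cf f-large , Acyclic.transfer x∈S ¬cx x-large

corollary5 : (n : ℕ) .{{_ : NonZero n}} (D : OrientedGraph n) →
    let open OrientedGraph D in
    MissingEdgesFormMatching →
    (∀ v → ¬ Sink v) →
    ∃₂ λ u v → u ≢ v × LargeSecondNeighborhood u × LargeSecondNeighborhood v
corollary5 n D matching = Transfer.two-large-second D matching (fromℕ< (>-nonZero⁻¹ n))
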